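{- Let $n,m$ be positive integers and $\alpha_1,\dots,\alpha_n$ the simple roots of type $A_n$. There exists a bijection $\psi_n:\mathcal{D}^m_n\to\mathcal{P}^m_n$ such that for every $i\in\{1,\dots,n\}$ and every $D\in\mathcal{D}^m_n$, the facet $D$ contains the negative simple root $-\alpha_i$ if and only if the $i$-th part of the partition $\psi_n(D)$ equals $(n-i+1)m$.
   Context: Let $P$ be a convex polygon with $m(n+1)+2$ vertices labeled $0,1,\dots,m(n+1)+1$ counterclockwise. An $m$-diagonal is a diagonal of $P$ dividing it into two polygons each with a number of vertices congruent to $2$ mod $m$. An $m$-dissection is a set of $n$ pairwise non-crossing $m$-diagonals; $\mathcal{D}^m_n$ is the set of $m$-dissections (the facets of the $m$-generalized cluster complex $\Delta^m(A_n)$). Negative simple roots: for $1\le i\le\frac{n+1}2$, $-\alpha_{2i-1}$ is the diagonal joining vertices $(i-1)m$ and $(n+1-i)m+1$; for $1\le i\le\frac n2$, $-\alpha_{2i}$ is the diagonal joining $im$ and $(n+1-i)m+1$. $D$ contains $-\alpha_i$ if that diagonal is in $D$. $\mathcal{P}^m_n$ is the set of integer partitions $\lambda=(\lambda_1\ge\cdots\ge\lambda_n\ge0)$ with $\lambda_i\le m(n-i+1)$ for all $i$. -}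

module Defs where

open import Data.Fin.Base using (Fin; toℕ)
import Data.Fin.Base as Fin
open import Data.List.Base using (List; length)
open import Data.List.Membership.Propositional using (_∈_)
open import Data.List.Relation.Binary.BagAndSetEquality using ([_]-Equality; set)
open import Data.List.Relation.Unary.All using (All)
open import Data.List.Relation.Unary.AllPairs using (AllPairs)
open import Data.List.Relation.Unary.Unique.Propositional using (Unique)
open import Data.Nat.Base
open import Data.Nat.DivMod using (_%_)
open import Data.Nat.Properties using (+-identityʳ; +-suc; n≡⌊n+n/2⌋; n≡⌈n+n/2⌉)
open import Data.Product.Base using (_×_; _,_)
open import Data.Sum.Base using (_⊎_)
open import Data.Vec.Base using (Vec; lookup)
open import Level using (0ℓ)
open import Relation.Binary.Bundles using (Setoid)
import Relation.Binary.Construct.On as On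
open import Relation.Binary.PropositionalEquality
  using (_≡_; _≢_; sym; trans; cong; cong₂; setoid)
open import Relation.Nullary.Negation.Core using (¬_)

-- The vertices of the polygon are the labels 0, …, polygonSize m n ∸ 1.
polygonSize : ℕ → ℕ → ℕ
polygonSize m n = m * (n + 1) + 2

-- A segment between two vertices is written (a , b) with a < b, so that each
-- segment is represented by exactly one pair.
Segment : Set
Segment = ℕ × ℕ

-- The last two conditions exclude the sides of the N-gon.
IsDiagonal : ℕ → Segment → Set
IsDiagonal N (a , b) = a < b × b < N × suc a ≢ b × ¬ (a ≡ 0 × suc b ≡ N)

-- The diagonal (a , b) of the N-gon cuts it into the polygon on the vertices
-- a, a+1, …, b and the one on b, b+1, …, N-1, 0, …, a; both contain a and b.
innerSize : Segment → ℕ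
innerSize (a , b) = (b ∸ a) + 1

outerSize : ℕ → Segment → ℕ
outerSize N (a , b) = (N ∸ (b ∸ a)) + 1

IsMDiagonal : (m n : ℕ) .{{_ : NonZero m}} → Segment → Set
IsMDiagonal m n d =
    IsDiagonal N d
  × innerSize d % m ≡ 2 % m
  × outerSize N d % m ≡ 2 % m
  where N = polygonSize m n

-- By convexity, two diagonals meet in their interiors exactly when their
-- endpoints strictly interleave.
Crossing : Segment → Segment → Set
Crossing (a , b) (c , d) = (a < c × c < b × b < d) ⊎ (c < a × a < d × d < b)

NonCrossing : Segment → Segment → Set
NonCrossing d e = ¬ Crossing d e

-- A finite set of diagonals is a duplicate-free list; the order of the list is
-- forgotten by the equality of Dissections.
record Dissection (m n : ℕ) .{{_ : NonZero m}} : Set where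
  field
    diagonals    : List Segment
    unique       : Unique diagonals
    size         : length diagonals ≡ n
    allMDiagonal : All (IsMDiagonal m n) diagonals
    nonCrossing  : AllPairs NonCrossing diagonals

open Dissection public

Dissections : (m n : ℕ) .{{_ : NonZero m}} → Setoid 0ℓ 0ℓ
Dissections m n = On.setoid ([ set ]-Equality Segment) (diagonals {m} {n})

-- Indices of simple roots and of parts run through 1, …, n.
index : ∀ {n} → Fin n → ℕ
index i = suc (toℕ i)

-- The diagonal -αᵢ, with i counted from 1. The cases of odd and even i are
-- negSimpleRoot-odd and negSimpleRoot-even.
negSimpleRoot : (m n i : ℕ) → Segment
negSimpleRoot m n i = ⌊ i /2⌋ * m , (n + 1 ∸ ⌈ i /2⌉) * m + 1

negSimpleRoot-odd : ∀ m n i .{{_ : NonZero i}} →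
  negSimpleRoot m n (2 * i ∸ 1) ≡ ((i ∸ 1) * m , (n + 1 ∸ i) * m + 1)
negSimpleRoot-odd m n (suc k) = cong₂ (λ x y → x * m , (n + 1 ∸ y) * m + 1) floor ceil
  where
  double : 2 * suc k ∸ 1 ≡ suc (k + k)
  double = trans (cong (k +_) (+-identityʳ (suc k))) (+-suc k k)

  floor : ⌊ 2 * suc k ∸ 1 /2⌋ ≡ k
  floor = trans (cong ⌊_/2⌋ double) (sym (n≡⌈n+n/2⌉ k))

  ceil : ⌈ 2 * suc k ∸ 1 /2⌉ ≡ suc k
  ceil = trans (cong ⌈_/2⌉ double) (cong suc (sym (n≡⌊n+n/2⌋ k)))

negSimpleRoot-even : ∀ m n i →
  negSimpleRoot m n (2 * i) ≡ (i * m , (n + 1 ∸ i) * m + 1)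
negSimpleRoot-even m n i = cong₂ (λ x y → x * m , (n + 1 ∸ y) * m + 1) floor ceil
  where
  double : 2 * i ≡ i + i
  double = cong (i +_) (+-identityʳ i)

  floor : ⌊ 2 * i /2⌋ ≡ i
  floor = trans (cong ⌊_/2⌋ double) (sym (n≡⌊n+n/2⌋ i))

  ceil : ⌈ 2 * i /2⌉ ≡ i
  ceil = trans (cong ⌈_/2⌉ double) (sym (n≡⌈n+n/2⌉ i))

ContainsNeg : ∀ {m n} .{{_ : NonZero m}} → Dissection m n → Fin n → Set
ContainsNeg {m} {n} D i = negSimpleRoot m n (index i) ∈ diagonals D

record Partition (m n : ℕ) : Set where
  field
    parts      : Vec ℕ n
    decreasing : ∀ {i j} → i Fin.≤ j → lookup parts i ≥ lookup parts j
    bounded    : ∀ i → lookup parts i ≤ m * (n ∸ index i + 1)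

open Partition public

part : ∀ {m n} → Partition m n → Fin n → ℕ
part p i = lookup (parts p) i

Partitions : (m n : ℕ) → Setoid 0ℓ 0ℓ
Partitions m n = On.setoid (setoid (Vec ℕ n)) (parts {m} {n})

{-# OPTIONS --safe #-}
module Submission where

-- After a rotation, list the vertices of the polygon as w₀, w₁, … so that each
-- is smaller than all later ones or greater than all later ones; every suffix
-- of the list is then an arc of consecutive vertices. Label a diagonal by the
-- position of the first of its endpoints in the list. The partition of a
-- dissection consists of the labels of its diagonals. An arc of m i + 2
-- vertices contains at most i diagonals, its closing chord included, and i only
-- if the closing chord is among them; this gives λᵢ ≤ m (n - i + 1), with
-- equality exactly when the closing chord of the i-th arc belongs to the
-- dissection. The list is chosen so that these closing chords are the -αᵢ.
-- A dissection is recovered greedily from its labels: the highest label v is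
-- that of an ear, the unique diagonal at w_v that cuts off m vertices of the arc
-- starting there. Removing these m vertices leaves a smaller polygon with the
-- remaining labels unchanged.

open import Defs
open import Data.Empty using (⊥; ⊥-elim)
open import Data.Fin.Base as Fin using (Fin; zero; suc; toℕ)
open import Data.Fin.Properties using (toℕ<n)
open import Data.List.Base using (List; []; _∷_; _++_; length; map; filter; applyDownFrom)
open import Data.List.Extrema.Nat
  using (argmax; argmin; argmax-sel; argmin-sel; f[xs]≤f[argmax]; f[argmin]≤f[xs])
open import Data.List.Membership.Propositional using (_∈_; _∉_; lose; find)
open import Data.List.Membership.Propositional.Properties
  using (∈-++⁺ʳ; ∈-map⁺; ∈-map⁻; ∈-applyDownFrom⁺; ∈-applyDownFrom⁻;
         ∈-∃++; ∈-filter⁺; ∈-filter⁻; ∈-length)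
open import Data.List.Properties
  using (filter-notAll; filter-accept; filter-reject; filter-all; filter-none;
         length-++; length-applyDownFrom; length-map; ++-assoc)
open import Data.List.Relation.Binary.Permutation.Propositional
  using (_↭_; prep; ↭-refl; ↭-sym; ↭-trans; ↭⇒↭ₛ)
open import Data.List.Relation.Binary.Permutation.Propositional.Properties
  using (∈-resp-↭; ↭-length; shift; filter-↭)
import Data.List.Relation.Binary.Permutation.Setoid.Properties as Permₛ
open import Data.List.Relation.Unary.All as All using (All; []; _∷_)
import Data.List.Relation.Unary.All.Properties as All
open import Data.List.Relation.Unary.AllPairs as AllPairs using (AllPairs; []; _∷_)
import Data.List.Relation.Unary.AllPairs.Properties as AllPairs
open import Data.List.Relation.Unary.Any as Any using (Any; here; there)
open import Data.List.Relation.Unary.Linked.Properties using (Linked⇒AllPairs)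
open import Data.List.Relation.Unary.Unique.Propositional using (Unique)
import Data.List.Relation.Unary.Unique.Propositional.Properties as Unique
open import Data.Nat.Base
open import Data.Nat.Divisibility using (_∣_; divides; ∣m+n∣m⇒∣n; m∣m*n; ∣m∣n⇒∣m+n)
open import Data.Nat.DivMod using (_%_; _/_; %-remove-+ˡ; m≡m%n+[m/n]*n)
open import Data.Nat.Properties
open import Data.List.Sort ≤-decTotalOrder using (sort; sort-↭; sort-↗)
open import Data.Nat.Solver using (module +-*-Solver)
open import Data.Product.Base using (_×_; _,_; proj₁; proj₂; ∃-syntax; Σ-syntax)
open import Data.Sum.Base as Sum using (_⊎_; inj₁; inj₂; [_,_]′)
open import Data.Vec.Base using (Vec; []; _∷_; lookup)
open import Function.Base using (_∘_; id; case_of_)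
open import Function.Bundles using (Bijection; _⇔_; mk⇔; module Equivalence)
open import Relation.Binary.Definitions using (tri<; tri≈; tri>)
open import Relation.Binary.PropositionalEquality
open import Relation.Nullary.Decidable using (yes; no; _×-dec_; _⊎-dec_; ¬?)
open import Relation.Nullary.Negation using (¬_; contradiction)
open import Relation.Unary using (Decidable)

open +-*-Solver

private variable
  A : Set
  x y v : ℕ
  ws P Q : List ℕ
  d e : Segment
  D : List Segment

-- Duplicate-free lists as finite sets.

remove-∈ : ∀ {x : A} {xs} → x ∈ xs → ∃[ ys ] xs ↭ x ∷ ys
remove-∈ x∈xs with ys , zs , refl ← ∈-∃++ x∈xs = ys ++ zs , shift _ ys zs

Unique-↭ : ∀ {xs ys : List A} → xs ↭ ys → Unique xs → Unique ys
Unique-↭ p = Permₛ.Unique-resp-↭ (setoid _) (↭⇒↭ₛ p)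

length-mono : ∀ {xs ys : List A} → Unique xs → (∀ {x} → x ∈ xs → x ∈ ys) → length xs ≤ length ys
length-mono {xs = []} _ _ = z≤n
length-mono {xs = x ∷ xs} (x∉xs ∷ xs!) xs⊆ys with ys′ , p ← remove-∈ (xs⊆ys (here refl)) =
  subst (suc (length xs) ≤_) (sym (↭-length p)) (s≤s (length-mono xs! (λ y∈xs →
    case ∈-resp-↭ p (xs⊆ys (there y∈xs)) of λ where
      (here refl) → contradiction refl (All.lookup x∉xs y∈xs)
      (there y∈ys′) → y∈ys′)))

length-filter-¬ : ∀ {P : A → Set} (P? : Decidable P) xs →
  length xs ≡ length (filter P? xs) + length (filter (¬? ∘ P?) xs)
length-filter-¬ P? [] = refl
length-filter-¬ P? (x ∷ xs) with P? x
... | yes _ = cong suc (length-filter-¬ P? xs)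
... | no _ = trans (cong suc (length-filter-¬ P? xs)) (sym (+-suc _ _))

-- Shells; labels, counts and contraction of segments.

-- Every suffix of a shell is an arc: no earlier vertex lies between two of its
-- members.
data Shell : List ℕ → Set where
  []  : Shell []
  _∷_ : All (x <_) P ⊎ All (_< x) P → Shell P → Shell (x ∷ P)

Shell⇒Unique : Shell ws → Unique ws
Shell⇒Unique [] = []
Shell⇒Unique (inj₁ lt ∷ s) = All.map <⇒≢ lt ∷ Shell⇒Unique s
Shell⇒Unique (inj₂ gt ∷ s) = All.map >⇒≢ gt ∷ Shell⇒Unique s

Shell-filter : ∀ {P : ℕ → Set} (P? : Decidable P) → Shell ws → Shell (filter P? ws)
Shell-filter P? [] = []
Shell-filter {ws = x ∷ ws} P? (o ∷ s) with P? x
... | no _ = Shell-filter P? s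
Shell-filter P? (inj₁ lt ∷ s) | yes _ = inj₁ (All.filter⁺ P? lt) ∷ Shell-filter P? s
Shell-filter P? (inj₂ gt ∷ s) | yes _ = inj₂ (All.filter⁺ P? gt) ∷ Shell-filter P? s

Shell-++ʳ : ∀ R → Shell (R ++ P) → Shell P
Shell-++ʳ [] s = s
Shell-++ʳ (_ ∷ R) (_ ∷ s) = Shell-++ʳ R s

Between : Segment → ℕ → Set
Between (a , b) x = a < x × x < b

-- Abstract so that it does not unfold and with-abstractions match it in filters.
abstract
  between? : ∀ d → Decidable (Between d)
  between? (a , b) x = (a <? x) ×-dec (x <? b)

Touches : Segment → ℕ → Set
Touches (a , b) x = x ≡ a ⊎ x ≡ b

touches? : ∀ d → Decidable (Touches d)
touches? (a , b) x = (x ≟ a) ⊎-dec (x ≟ b)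

count : List ℕ → Segment → ℕ
count ws d = length (filter (between? d) ws)

contract : Segment → List ℕ → List ℕ
contract d ws = filter (¬? ∘ between? d) ws

-- When neither endpoint of d occurs in ws, this is length ws.
label : List ℕ → Segment → ℕ
label [] d = 0
label (x ∷ ws) d with touches? d x
... | yes _ = 0
... | no _ = suc (label ws d)

Avoids : Segment → Segment → Set
Avoids d (p , q) = ¬ Between d p × ¬ Between d q

Ends : List ℕ → Segment → Set
Ends ws (a , b) = a ∈ ws × b ∈ ws

-- The head is extremal, so both ends of `d` lie on the same side of it.
Shell-¬Between : Shell (x ∷ P) → Ends P d → ¬ Between d x
Shell-¬Between (inj₁ lt ∷ _) (a∈ , b∈) (a<x , x<b) = <-asym a<x (All.lookup lt a∈)
Shell-¬Between (inj₂ gt ∷ _) (a∈ , b∈) (a<x , x<b) = <-asym x<b (All.lookup gt b∈)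

Ends-tail : ¬ Touches d x → Ends (x ∷ P) d → Ends P d
Ends-tail ¬t (here refl , _) = contradiction (inj₁ refl) ¬t
Ends-tail ¬t (there a∈ , here refl) = contradiction (inj₂ refl) ¬t
Ends-tail ¬t (there a∈ , there b∈) = a∈ , b∈

Encloses : Segment → Segment → Set
Encloses (p , q) (a , b) = p ≤ a × b ≤ q

-- The first vertex met cannot be an end of the inner segment `e` alone: it would lie strictly
-- inside `d`, both of whose ends come later.
label-mono : Shell ws → Ends ws d → Ends ws e → proj₁ e < proj₂ e → Encloses d e →
  label ws d ≤ label ws e
label-mono [] (() , _)
label-mono {x ∷ ws} {d} {e} S@(_ ∷ s) d∈ e∈ p<q (a≤p , q≤b) with touches? d x
... | yes _ = z≤n
... | no ¬t with touches? e x
...   | no ¬u = s≤s (label-mono s (Ends-tail ¬t d∈) (Ends-tail ¬u e∈) p<q (a≤p , q≤b))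
...   | yes (inj₁ refl) = contradiction (≤∧≢⇒< a≤p (λ eq → ¬t (inj₁ (sym eq))) , <-≤-trans p<q q≤b)
                            (Shell-¬Between {d = d} S (Ends-tail ¬t d∈))
...   | yes (inj₂ refl) = contradiction (≤-<-trans a≤p p<q , ≤∧≢⇒< q≤b (λ eq → ¬t (inj₂ eq)))
                            (Shell-¬Between {d = d} S (Ends-tail ¬t d∈))

Touches⇒¬Between : Touches d x → ¬ Between d x
Touches⇒¬Between (inj₁ refl) (a<a , _) = <-irrefl refl a<a
Touches⇒¬Between (inj₂ refl) (_ , b<b) = <-irrefl refl b<b

Shell-¬Between′ : Shell (x ∷ P) → Ends (x ∷ P) d → ¬ Between d x
Shell-¬Between′ {x} {d = d} S d∈ with touches? d x
... | yes t = Touches⇒¬Between {d} t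
... | no ¬t = Shell-¬Between {d = d} S (Ends-tail ¬t d∈)

contract-keep : ∀ d → ¬ Between d x → contract d (x ∷ ws) ≡ x ∷ contract d ws
contract-keep d = filter-accept (¬? ∘ between? d)

-- Contraction along d only removes vertices after position label ws d.
label-contract : ∀ ws d e → Shell ws → Ends ws d → Avoids d e →
  label ws e ≤ label ws d ⊎ label (contract d ws) e ≤ label ws d →
  label (contract d ws) e ≡ label ws e
label-contract [] d e [] (() , _)
label-contract (x ∷ ws) d e S@(_ ∷ s) d∈ av =
  subst (λ l → label (x ∷ ws) e ≤ label (x ∷ ws) d ⊎ label l e ≤ label (x ∷ ws) d →
    label l e ≡ label (x ∷ ws) e)
    (sym (contract-keep d (Shell-¬Between′ {d = d} S d∈))) step
  where
  step : label (x ∷ ws) e ≤ label (x ∷ ws) d ⊎ label (x ∷ contract d ws) e ≤ label (x ∷ ws) d →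
    label (x ∷ contract d ws) e ≡ label (x ∷ ws) e
  -- If the head is an end of `d` but not of `e`, either form of the hypothesis bounds a positive
  -- label by 0, so that case is absent.
  step le with touches? e x | touches? d x
  step _ | yes _ | _ = refl
  step (inj₁ (s≤s l)) | no _ | no ¬u =
    cong suc (label-contract ws d e s (Ends-tail ¬u d∈) av (inj₁ l))
  step (inj₂ (s≤s l)) | no _ | no ¬u =
    cong suc (label-contract ws d e s (Ends-tail ¬u d∈) av (inj₂ l))

count-out : ∀ d → ¬ Between d x → count (x ∷ ws) d ≡ count ws d
count-out d ¬bt = cong length (filter-reject (between? d) ¬bt)

length-contract : ∀ ws d → length ws ≡ count ws d + length (contract d ws)
length-contract ws d = length-filter-¬ (between? d) ws

count-contract-⊇ : ∀ ws d e → Encloses e d → count ws e ≡ count (contract d ws) e + count ws d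
count-contract-⊇ [] d e _ = refl
count-contract-⊇ (x ∷ ws) d e enc@(p≤a , b≤q)
  with ih ← count-contract-⊇ ws d e enc | between? d x
... | no _ with between? e x
...   | yes _ = cong suc ih
...   | no _ = ih
count-contract-⊇ (x ∷ ws) d e enc@(p≤a , b≤q) | yes (a<x , x<b) with between? e x
...   | yes _ = trans (cong suc ih) (sym (+-suc _ _))
...   | no ¬bt = contradiction (≤-<-trans p≤a a<x , <-≤-trans x<b b≤q) ¬bt

count-contract-∥ : ∀ ws d e → (∀ {x} → Between d x → ¬ Between e x) →
  count ws e ≡ count (contract d ws) e
count-contract-∥ [] d e _ = refl
count-contract-∥ (x ∷ ws) d e dis with ih ← count-contract-∥ ws d e dis | between? d x
... | yes bt = trans (count-out e (dis bt)) ih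
... | no _ with between? e x
...   | yes _ = cong suc ih
...   | no _ = ih

-- Uniqueness and existence of ears.

count-< : Encloses e d → y ∈ ws → Between e y → ¬ Between d y → count ws d < count ws e
count-< {e} {d} {ws = ws} enc y∈ bt ¬bt rewrite count-contract-⊇ ws d e enc =
  m<n+m (count ws d) (∈-length (∈-filter⁺ (between? e) (∈-filter⁺ (¬? ∘ between? d) y∈ ¬bt) bt))

IsSegment : Segment → Set
IsSegment (a , b) = a < b

least-end : All (x <_) ws → IsSegment d → Ends (x ∷ ws) d → Touches d x → x ≡ proj₁ d × proj₂ d ∈ ws
least-end lt a<b (a∈ , here refl) (inj₁ refl) = contradiction a<b (<-irrefl refl)
least-end lt a<b (a∈ , there b∈) (inj₁ refl) = refl , b∈
least-end lt a<b (here refl , b∈) (inj₂ refl) = contradiction a<b (<-irrefl refl)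
least-end lt a<b (there a∈ , b∈) (inj₂ refl) = contradiction a<b (<-asym (All.lookup lt a∈))

greatest-end : All (_< x) ws → IsSegment d → Ends (x ∷ ws) d → Touches d x →
  x ≡ proj₂ d × proj₁ d ∈ ws
greatest-end gt a<b (here refl , b∈) (inj₂ refl) = contradiction a<b (<-irrefl refl)
greatest-end gt a<b (there a∈ , b∈) (inj₂ refl) = refl , a∈
greatest-end gt a<b (a∈ , here refl) (inj₁ refl) = contradiction a<b (<-irrefl refl)
greatest-end gt a<b (a∈ , there b∈) (inj₁ refl) = contradiction a<b (<-asym (All.lookup gt b∈))

count-<ʳ : ∀ {a b q} → a < b → b < q → b ∈ ws → count ws (a , b) < count ws (a , q)
count-<ʳ {ws} {a} {b} {q} a<b b<q b∈ = count-< {a , q} {a , b} {ws = ws}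
  (≤-refl , <⇒≤ b<q) b∈ (a<b , b<q) λ bt → <-irrefl refl (proj₂ bt)

count-<ˡ : ∀ {a b p} → p < a → a < b → a ∈ ws → count ws (a , b) < count ws (p , b)
count-<ˡ {ws} {a} {b} {p} p<a a<b a∈ = count-< {p , b} {a , b} {ws = ws}
  (<⇒≤ p<a , ≤-refl) a∈ (p<a , a<b) λ bt → <-irrefl refl (proj₁ bt)

-- Both segments end in the vertex at position label ws d, which is extremal among
-- the later ones, so they are nested and count tells them apart.
ear-unique : Shell ws → IsSegment d → IsSegment e → Ends ws d → Ends ws e →
  label ws d ≡ label ws e → count ws d ≡ count ws e → d ≡ e
ear-unique [] _ _ (() , _)
ear-unique {x ∷ ws} {d} {e} S@(o ∷ s) a<b p<q d∈ e∈ l≡ c≡ with touches? d x | touches? e x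
... | yes _ | no _ = case l≡ of λ ()
... | no _ | yes _ = case l≡ of λ ()
... | no ¬t | no ¬u = ear-unique s a<b p<q (Ends-tail ¬t d∈) (Ends-tail ¬u e∈) (suc-injective l≡)
      (trans (sym (count-out d (Shell-¬Between′ {d = d} S d∈)))
        (trans c≡ (count-out e (Shell-¬Between′ {d = e} S e∈))))
ear-unique {x ∷ ws} (inj₁ lt ∷ _) a<b p<q d∈ e∈ _ c≡ | yes t | yes u
  with refl , b∈ ← least-end lt a<b d∈ t | refl , q∈ ← least-end lt p<q e∈ u with <-cmp _ _
... | tri< b<q _ _ = contradiction c≡ (<⇒≢ (count-<ʳ {x ∷ ws} a<b b<q (there b∈)))
... | tri≈ _ refl _ = refl
... | tri> _ _ q<b = contradiction c≡ (>⇒≢ (count-<ʳ {x ∷ ws} p<q q<b (there q∈)))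
ear-unique {x ∷ ws} (inj₂ gt ∷ _) a<b p<q d∈ e∈ _ c≡ | yes t | yes u
  with refl , a∈ ← greatest-end gt a<b d∈ t | refl , p∈ ← greatest-end gt p<q e∈ u with <-cmp _ _
... | tri< a<p _ _ = contradiction c≡ (>⇒≢ (count-<ˡ {x ∷ ws} a<p p<q (there p∈)))
... | tri≈ _ refl _ = refl
... | tri> _ _ p<a = contradiction c≡ (<⇒≢ (count-<ˡ {x ∷ ws} p<a a<b (there a∈)))

rank : AllPairs _<_ ws → ∀ i j → length ws ≡ i + suc j →
  ∃[ p ] p ∈ ws × length (filter (_<? p) ws) ≡ i × length (filter (p <?_) ws) ≡ j
rank [] zero j ()
rank [] (suc i) j ()
rank {p ∷ ws} (lt ∷ _) zero j eq = p , here refl ,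
  cong length
    (trans (filter-reject (_<? p) (<-irrefl refl)) (filter-none (_<? p) (All.map <⇒≯ lt))) ,
  trans (cong length (trans (filter-reject (p <?_) (<-irrefl refl)) (filter-all (p <?_) lt)))
    (suc-injective eq)
rank {x ∷ ws} (lt ∷ s) (suc i) j eq with p , p∈ , below , above ← rank s i j (suc-injective eq) =
  p , there p∈ ,
  trans (cong length (filter-accept (_<? p) (All.lookup lt p∈))) (cong suc below) ,
  trans (cong length (filter-reject (p <?_) (<-asym (All.lookup lt p∈)))) above

sort-strict : Unique ws → AllPairs _<_ (sort ws)
sort-strict {ws} ws! = AllPairs.zipWith (λ (x≤y , x≢y) → ≤∧≢⇒< x≤y x≢y)
  (Linked⇒AllPairs ≤-trans (sort-↗ ws) , Unique-↭ (↭-sym (sort-↭ ws)) ws!)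

-- Both counts are invariant under permutation, so the element can be looked up in the sorted list.
select : Unique ws → ∀ i j → length ws ≡ i + suc j →
  ∃[ p ] p ∈ ws × length (filter (_<? p) ws) ≡ i × length (filter (p <?_) ws) ≡ j
select {ws} ws! i j eq
  with p , p∈ , below , above ← rank (sort-strict ws!) i j (trans (↭-length (sort-↭ ws)) eq) =
  p , ∈-resp-↭ (sort-↭ ws) p∈ ,
  trans (sym (↭-length (filter-↭ (_<? p) (sort-↭ ws)))) below ,
  trans (sym (↭-length (filter-↭ (p <?_) (sort-↭ ws)))) above

filter-cong : ∀ {P Q : A → Set} (P? : Decidable P) (Q? : Decidable Q) {xs} →
  All (λ x → P x ⇔ Q x) xs → filter P? xs ≡ filter Q? xs
filter-cong P? Q? [] = refl
filter-cong P? Q? (_∷_ {x} eq eqs) with P? x | Q? x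
... | yes _ | yes _ = cong (x ∷_) (filter-cong P? Q? eqs)
... | no _ | no _ = filter-cong P? Q? eqs
... | yes p | no ¬q = contradiction (Equivalence.to eq p) ¬q
... | no ¬p | yes q = contradiction (Equivalence.from eq q) ¬p

label-here : Touches d x → label (x ∷ ws) d ≡ 0
label-here {d} {x} t with touches? d x
... | yes _ = refl
... | no ¬t = contradiction t ¬t

label-there : ¬ Touches d x → label (x ∷ ws) d ≡ suc (label ws d)
label-there {d} {x} ¬t with touches? d x
... | yes t = contradiction t ¬t
... | no _ = refl

Ends-¬Touches : x ∉ ws → Ends ws d → ¬ Touches d x
Ends-¬Touches x∉ (a∈ , _) (inj₁ refl) = x∉ a∈
Ends-¬Touches x∉ (_ , b∈) (inj₂ refl) = x∉ b∈

-- The vertex at position `v` is extremal among the later ones. Its partner is the later vertex of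
-- the right rank: `c` later vertices lie below it if the first end is least, above it if the first
-- end is greatest.
ear-exists : Shell ws → ∀ v c → v + suc (suc c) ≤ length ws →
  ∃[ d ] IsSegment d × Ends ws d × label ws d ≡ v × count ws d ≡ c
ear-exists [] zero c ()
ear-exists [] (suc v) c ()
ear-exists {x ∷ ws} S@(_ ∷ s) (suc v) c (s≤s le)
  with d , a<b , d∈@(a∈ , b∈) , l , k ← ear-exists s v c le =
  d , a<b , (there a∈ , there b∈) ,
  trans (label-there (Ends-¬Touches {d = d} (Unique.Unique[x∷xs]⇒x∉xs (Shell⇒Unique S)) d∈))
    (cong suc l) ,
  trans (count-out d (Shell-¬Between {d = d} S d∈)) k
ear-exists {x ∷ ws} (inj₁ lt ∷ s) zero c (s≤s le) with j , eq ← m≤n⇒∃[o]m+o≡n le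
  with p , p∈ , below , _ ← select (Shell⇒Unique s) c j (trans (sym eq) (sym (+-suc c j))) =
  (x , p) , All.lookup lt p∈ , (here refl , there p∈) , label-here {x , p} (inj₁ refl) ,
  trans (count-out (x , p) λ bt → <-irrefl refl (proj₁ bt))
    (trans (cong length
      (filter-cong (between? (x , p)) (_<? p) (All.map (λ x<y → mk⇔ proj₂ (x<y ,_)) lt))) below)
ear-exists {x ∷ ws} (inj₂ gt ∷ s) zero c (s≤s le) with j , eq ← m≤n⇒∃[o]m+o≡n le
  with p , p∈ , _ , above ← select (Shell⇒Unique s) j c (trans (sym eq) (+-comm (suc c) j)) =
  (p , x) , All.lookup gt p∈ , (there p∈ , here refl) , label-here {p , x} (inj₂ refl) ,
  trans (count-out (p , x) λ bt → <-irrefl refl (proj₂ bt))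
    (trans (cong length
      (filter-cong (between? (p , x)) (p <?_) (All.map (λ y<x → mk⇔ proj₁ (_, y<x)) gt))) above)

contract-Ends : Ends ws e → Avoids d e → Ends (contract d ws) e
contract-Ends {d = d} (p∈ , q∈) (¬p , ¬q) =
  ∈-filter⁺ (¬? ∘ between? d) p∈ ¬p , ∈-filter⁺ (¬? ∘ between? d) q∈ ¬q

contract-Ends⁻ : Ends (contract d ws) e → Ends ws e × Avoids d e
contract-Ends⁻ {d} {ws} (p∈ , q∈)
  with p∈ , ¬p ← ∈-filter⁻ (¬? ∘ between? d) {xs = ws} p∈
     | q∈ , ¬q ← ∈-filter⁻ (¬? ∘ between? d) {xs = ws} q∈ =
  (p∈ , q∈) , (¬p , ¬q)

-- Relative position of noncrossing segments.

Outside : Segment → ℕ → Set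
Outside (a , b) x = x < a ⊎ b < x

data Apart (d e : Segment) : Set where
  encloses : Encloses e d → Apart d e
  before   : proj₂ e ≤ proj₁ d → Apart d e
  after    : proj₂ d ≤ proj₁ e → Apart d e

-- Each end of `e` is at most `a` or at least `b`.
apart : ∀ d e → Avoids d e → Apart d e
apart (a , b) (p , q) (¬p , ¬q) with p ≤? a | q ≤? a | b ≤? p | b ≤? q
... | _ | yes q≤a | _ | _ = before q≤a
... | _ | _ | yes b≤p | _ = after b≤p
... | yes p≤a | _ | _ | yes b≤q = encloses (p≤a , b≤q)
... | no p≰a | _ | no b≰p | _ = contradiction (≰⇒> p≰a , ≰⇒> b≰p) ¬p
... | _ | no q≰a | _ | no b≰q = contradiction (≰⇒> q≰a , ≰⇒> b≰q) ¬q

width : Segment → ℕ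
width (a , b) = b ∸ a

-- An end of `e` strictly inside `d` keeps the other end from passing beyond `d`, and its strictness
-- makes `e` narrower.
noncrossing⇒Encloses : IsSegment d → IsSegment e → NonCrossing d e →
  Between d (proj₁ e) ⊎ Between d (proj₂ e) → Encloses d e × width e < width d
noncrossing⇒Encloses {a , b} {p , q} a<b p<q nc (inj₁ (a<p , p<b)) with b <? q
... | yes b<q = contradiction (inj₁ (a<p , p<b , b<q)) nc
... | no b≮q = (<⇒≤ a<p , ≮⇒≥ b≮q) , ≤-<-trans (∸-monoˡ-≤ p (≮⇒≥ b≮q)) (∸-monoʳ-< a<p (<⇒≤ p<b))
noncrossing⇒Encloses {a , b} {p , q} a<b p<q nc (inj₂ (a<q , q<b)) with p <? a
... | yes p<a = contradiction (inj₂ (p<a , a<q , q<b)) nc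
... | no p≮a = (≮⇒≥ p≮a , <⇒≤ q<b) , ≤-<-trans (∸-monoʳ-≤ q (≮⇒≥ p≮a)) (∸-monoˡ-< q<b (<⇒≤ a<q))

-- Such a diagonal may cut off any positive multiple of m vertices. That the number is m when there
-- are as many diagonals as possible is shown by counting in `encode`.
record Ear (ws : List ℕ) (D : List Segment) (d : Segment) : Set where
  field
    member : d ∈ D
    highest : ∀ {e} → e ∈ D → label ws e ≤ label ws d
    innermost : ∀ {e} → e ∈ D → Avoids d e

-- The vertices before the first end are not inside `d`, so they, the two ends and the inner
-- vertices are all distinct.
label-count-bound : Shell ws → IsSegment d → Ends ws d →
  label ws d + suc (suc (count ws d)) ≤ length ws
label-count-bound [] _ (() , _)
label-count-bound {x ∷ ws} {d} S@(o ∷ s) a<b d∈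
  rewrite count-out {ws = ws} d (Shell-¬Between′ {d = d} S d∈) with touches? d x
... | no ¬t = s≤s (label-count-bound s a<b (Ends-tail ¬t d∈))
... | yes t = s≤s (filter-notAll (between? d) ws (other o))
  where
  other : All (x <_) ws ⊎ All (_< x) ws → Any (λ y → ¬ Between d y) ws
  other (inj₁ lt) = lose (proj₂ (least-end {d = d} lt a<b d∈ t)) λ bt → <-irrefl refl (proj₂ bt)
  other (inj₂ gt) = lose (proj₂ (greatest-end {d = d} gt a<b d∈ t)) λ bt → <-irrefl refl (proj₁ bt)

nonempty : ∀ {xs : List A} → 0 < length xs → ∃[ x ] x ∈ xs
nonempty {xs = x ∷ _} _ = x , here refl

Avoids⇒NonCrossing : ∀ d e → Avoids d e → NonCrossing d e
Avoids⇒NonCrossing d e (¬p , ¬q) (inj₁ (a<p , p<b , _)) = ¬p (a<p , p<b)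
Avoids⇒NonCrossing d e (¬p , ¬q) (inj₂ (_ , a<q , q<b)) = ¬q (a<q , q<b)

Crossing-sym : ∀ d e → Crossing d e → Crossing e d
Crossing-sym d e (inj₁ x) = inj₂ x
Crossing-sym d e (inj₂ x) = inj₁ x

-- Closing chords of arcs, and shells with a prefix.

-- The closing chord of the arc `Q`. After the rotation the arcs in question are intervals of
-- labels, possibly thinned by contractions, so the chord joins the extremes.
record Chord (Q : List ℕ) (d : Segment) : Set where
  field
    segment : IsSegment d
    ends : Ends Q d
    spans : ∀ {x} → x ∈ Q → proj₁ d ≤ x × x ≤ proj₂ d

-- A head other than an end would lie strictly inside the chord, contrary to its being extremal.
Chord-label : Shell Q → Chord Q d → label Q d ≡ 0
Chord-label [] record { ends = () , _ }
Chord-label {x ∷ Q} {d} S c with touches? d x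
... | yes _ = refl
... | no ¬t with a≤x , x≤b ← Chord.spans c (here refl) =
      contradiction (≤∧≢⇒< a≤x (λ eq → ¬t (inj₁ (sym eq))) , ≤∧≢⇒< x≤b (λ eq → ¬t (inj₂ eq)))
        (Shell-¬Between {d = d} S (Ends-tail ¬t (Chord.ends c)))

-- Contracting `Q` along its closing chord leaves exactly the two ends.
Chord-count : Shell Q → Chord Q d → length Q ≡ count Q d + 2
Chord-count {Q} {d@(a , b)} S c = trans (length-contract Q d) (cong (count Q d +_) (≤-antisym
  (length-mono {ys = a ∷ b ∷ []} (Unique.filter⁺ (¬? ∘ between? d) (Shell⇒Unique S)) end)
  (length-mono {xs = a ∷ b ∷ []} ((<⇒≢ segment ∷ []) ∷ [] ∷ []) λ where
    (here refl) → ∈-filter⁺ (¬? ∘ between? d) (proj₁ ends) λ bt → <-irrefl refl (proj₁ bt)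
    (there (here refl)) → ∈-filter⁺ (¬? ∘ between? d) (proj₂ ends) λ bt →
      <-irrefl refl (proj₂ bt))))
  where
  open Chord c
  end : ∀ {x} → x ∈ contract d Q → x ∈ a ∷ b ∷ []
  end {x} x∈′ with x∈ , ¬bt ← ∈-filter⁻ (¬? ∘ between? d) {xs = Q} x∈′ with touches? d x
  ... | yes (inj₁ refl) = here refl
  ... | yes (inj₂ refl) = there (here refl)
  ... | no ¬t with a≤x , x≤b ← spans x∈ =
        contradiction (≤∧≢⇒< a≤x (λ eq → ¬t (inj₁ (sym eq))) , ≤∧≢⇒< x≤b (λ eq → ¬t (inj₂ eq))) ¬bt

Ends-++ : ∀ R → Ends Q d → Ends (R ++ Q) d
Ends-++ R (a∈ , b∈) = ∈-++⁺ʳ R a∈ , ∈-++⁺ʳ R b∈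

label-++ : ∀ R → Shell (R ++ Q) → Ends Q d → label (R ++ Q) d ≡ length R + label Q d
label-++ [] _ _ = refl
label-++ {Q} {d} (x ∷ R) S@(_ ∷ s) d∈ =
  trans
    (label-there {d}
      (Ends-¬Touches {d = d} (Unique.Unique[x∷xs]⇒x∉xs (Shell⇒Unique S)) (Ends-++ {Q} {d} R d∈)))
    (cong suc (label-++ R s d∈))

Ends-++⁻ : ∀ R → Ends (R ++ Q) d → length R ≤ label (R ++ Q) d → Ends Q d
Ends-++⁻ [] d∈ _ = d∈
Ends-++⁻ {Q} {d} (x ∷ R) d∈ le with touches? d x
Ends-++⁻ {Q} {d} (x ∷ R) d∈ (s≤s le) | no ¬t = Ends-++⁻ R (Ends-tail ¬t d∈) le

contract-++ : ∀ R → Shell (R ++ Q) → Ends Q d → contract d (R ++ Q) ≡ R ++ contract d Q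
contract-++ [] _ _ = refl
contract-++ {Q} {d} (x ∷ R) S@(_ ∷ s) d∈ =
  trans (contract-keep d (Shell-¬Between {d = d} S (Ends-++ {Q} {d} R d∈)))
    (cong (x ∷_) (contract-++ R s d∈))

count-++ : ∀ R → Shell (R ++ Q) → Ends Q d → count (R ++ Q) d ≡ count Q d
count-++ [] _ _ = refl
count-++ {Q} {d} (x ∷ R) S@(_ ∷ s) d∈ =
  trans (count-out d (Shell-¬Between {d = d} S (Ends-++ {Q} {d} R d∈))) (count-++ R s d∈)

Chord-contract : Ends Q e → Chord Q d → Chord (contract e Q) d
Chord-contract {Q} {e} {d} (p∈ , q∈) c = record
  { segment = segment
  ; ends = contract-Ends {d = e} ends
      ((λ (p<a , _) → <⇒≱ p<a (proj₁ (spans p∈))) , (λ (_ , b<q) → <⇒≱ b<q (proj₂ (spans q∈))))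
  ; spans = λ x∈ → spans (proj₁ (∈-filter⁻ (¬? ∘ between? e) {xs = Q} x∈))
  }
  where open Chord c

-- Sets of noncrossing diagonals under contraction.

-- A polygon with m * suc n + 2 vertices is dissected into suc n cells by n diagonals.
module Polygon (m : ℕ) where

  -- The fields between and outside say that d is not a side of the polygon ws.
  record Good (ws : List ℕ) (d : Segment) : Set where
    field
      segment : IsSegment d
      ends : Ends ws d
      divisible : m ∣ count ws d
      between : ∃[ x ] x ∈ ws × Between d x
      outside : ∃[ x ] x ∈ ws × Outside d x

  record Valid (ws : List ℕ) (D : List Segment) : Set where
    field
      distinct : Unique D
      good : ∀ {d} → d ∈ D → Good ws d
      noncrossing : ∀ {d e} → d ∈ D → e ∈ D → NonCrossing d e

  -- The count of `e` either is unchanged or drops by the count of `d`, a multiple of `m`.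
  m∣count : ∀ ws d e → m ∣ count ws d → Avoids d e → m ∣ count ws e ⇔ m ∣ count (contract d ws) e
  m∣count ws d e m∣d av with apart d e av
  ... | encloses enc rewrite count-contract-⊇ ws d e enc =
          mk⇔ (λ m∣e → ∣m+n∣m⇒∣n (subst (m ∣_) (+-comm (count (contract d ws) e) _) m∣e) m∣d)
            (λ m∣e → ∣m∣n⇒∣m+n m∣e m∣d)
  ... | before q≤a
          rewrite count-contract-∥ ws d e (λ (a<x , _) (_ , x<q) → <-asym a<x (<-≤-trans x<q q≤a)) =
          mk⇔ id id
  ... | after b≤p
          rewrite count-contract-∥ ws d e (λ (_ , x<b) (p<x , _) → <-asym x<b (≤-<-trans b≤p p<x)) =
          mk⇔ id id

  Good-contract⁻ : m ∣ count ws d → Good (contract d ws) e → Good ws e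
  Good-contract⁻ {ws} {d} {e} m∣d g with e∈ , av ← contract-Ends⁻ {d} {ws} {e} (Good.ends g) =
    record
    { segment = Good.segment g
    ; ends = e∈
    ; divisible = Equivalence.from (m∣count ws d e m∣d av) (Good.divisible g)
    ; between = case Good.between g of λ (x , x∈ , bt) →
      x , proj₁ (∈-filter⁻ (¬? ∘ between? d) {xs = ws} x∈) , bt
    ; outside = case Good.outside g of λ (x , x∈ , out) →
      x , proj₁ (∈-filter⁻ (¬? ∘ between? d) {xs = ws} x∈) , out
    }

  -- The point is that `e` does not become a side. The vertices witnessing this survive, or an end
  -- of `d` replaces them; when `e` encloses `d`, the hypothesis `e ≢ d` puts such an end strictly
  -- inside `e`.
  Good-contract : Good ws d → Good ws e → e ≢ d → Avoids d e → Good (contract d ws) e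
  Good-contract {ws} {a , b} {p , q} gd ge e≢d av = record
    { segment = Good.segment ge
    ; ends = contract-Ends {d = a , b} (Good.ends ge) av
    ; divisible = Equivalence.to (m∣count ws (a , b) (p , q) (Good.divisible gd) av)
      (Good.divisible ge)
    ; between = case apart (a , b) (p , q) av of λ where
        (encloses (p≤a , b≤q)) → case p ≟ a of λ where
          (yes refl) → b , keep (proj₂ (Good.ends gd)) (λ bt → <-irrefl refl (proj₂ bt)) ,
            Good.segment gd , ≤∧≢⇒< b≤q λ { refl → e≢d refl }
          (no p≢a) → a , keep (proj₁ (Good.ends gd)) (λ bt → <-irrefl refl (proj₁ bt)) ,
            ≤∧≢⇒< p≤a p≢a , <-≤-trans (Good.segment gd) b≤q
        (before q≤a) → case Good.between ge of λ (x , x∈ , bt) →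
          x , keep x∈ (λ (a<x , _) → <-asym a<x (<-≤-trans (proj₂ bt) q≤a)) , bt
        (after b≤p) → case Good.between ge of λ (x , x∈ , bt) →
          x , keep x∈ (λ (_ , x<b) → <-asym x<b (≤-<-trans b≤p (proj₁ bt))) , bt
    ; outside = case apart (a , b) (p , q) av of λ where
        (encloses (p≤a , b≤q)) → case Good.outside ge of λ where
          (x , x∈ , inj₁ x<p) → x , keep x∈ (λ (a<x , _) → <-asym a<x (<-≤-trans x<p p≤a)) ,
            inj₁ x<p
          (x , x∈ , inj₂ q<x) → x , keep x∈ (λ (_ , x<b) → <-asym x<b (≤-<-trans b≤q q<x)) ,
            inj₂ q<x
        (before q≤a) → b , keep (proj₂ (Good.ends gd)) (λ bt → <-irrefl refl (proj₂ bt)) ,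
          inj₂ (≤-<-trans q≤a (Good.segment gd))
        (after b≤p) → a , keep (proj₁ (Good.ends gd)) (λ bt → <-irrefl refl (proj₁ bt)) ,
          inj₁ (<-≤-trans (Good.segment gd) b≤p)
    }
    where
    keep : ∀ {x} → x ∈ ws → ¬ Between (a , b) x → x ∈ contract (a , b) ws
    keep = ∈-filter⁺ (¬? ∘ between? (a , b))

  Valid-↭ : ∀ {D D′} → D ↭ D′ → Valid ws D → Valid ws D′
  Valid-↭ p v = record
    { distinct = Unique-↭ p distinct
    ; good = λ d∈ → good (∈-resp-↭ (↭-sym p) d∈)
    ; noncrossing = λ d∈ e∈ → noncrossing (∈-resp-↭ (↭-sym p) d∈) (∈-resp-↭ (↭-sym p) e∈)
    }
    where open Valid v

  Valid-contract : Valid ws (d ∷ D) → (∀ {e} → e ∈ D → Avoids d e) → Valid (contract d ws) D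
  Valid-contract v av with d∉D ∷ D! ← Valid.distinct v = record
    { distinct = D!
    ; good = λ e∈ → Good-contract (good (here refl)) (good (there e∈))
      (λ { refl → All.lookup d∉D e∈ refl }) (av e∈)
    ; noncrossing = λ d∈ e∈ → noncrossing (there d∈) (there e∈)
    }
    where open Valid v

  -- The narrowest diagonal of highest label: a diagonal ending strictly inside it
  -- would be narrower and, by label-mono, have the same label.
  ear : Shell ws → Valid ws D → d ∈ D → ∃[ e ] Ear ws D e
  ear {ws} {D} {d} s v d∈D = low , record
    { member = low∈D
    ; highest = λ {f} f∈ → subst (label ws f ≤_) (sym (proj₂ low∈)) (top-max f∈)
    ; innermost = λ f∈ → (λ bt → absurd f∈ (inj₁ bt)) , (λ bt → absurd f∈ (inj₂ bt))
    }
    where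
    open Valid v
    -- The default `d` lies in `D`, and the default `top` of `argmin` below has the highest label,
    -- so both extrema are genuine candidates.
    top = argmax (label ws) d D
    top∈D : top ∈ D
    top∈D = [ (λ eq → subst (_∈ D) (sym eq) d∈D) , id ]′ (argmax-sel (label ws) d D)
    top-max : ∀ {f} → f ∈ D → label ws f ≤ label ws top
    top-max = All.lookup (f[xs]≤f[argmax] d D)
    is-top? : Decidable (λ f → label ws f ≡ label ws top)
    is-top? f = label ws f ≟ label ws top
    tops = filter is-top? D
    low = argmin width top tops
    low∈ : low ∈ D × label ws low ≡ label ws top
    low∈ = [ (λ eq → subst (λ f → f ∈ D × label ws f ≡ label ws top) (sym eq) (top∈D , refl)) ,
      ∈-filter⁻ is-top? ]′
      (argmin-sel width top tops)
    low∈D = proj₁ low∈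
    absurd : ∀ {f} → f ∈ D → Between low (proj₁ f) ⊎ Between low (proj₂ f) → ⊥
    absurd {f} f∈ bt with enc , lt ← noncrossing⇒Encloses (Good.segment (good low∈D))
      (Good.segment (good f∈)) (noncrossing low∈D f∈) bt =
      <⇒≱ lt (All.lookup (f[argmin]≤f[xs] top tops) (∈-filter⁺ is-top? f∈
        (≤-antisym (top-max f∈) (subst (_≤ label ws f) (proj₂ low∈)
          (label-mono s (Good.ends (good low∈D)) (Good.ends (good f∈)) (Good.segment (good f∈))
            enc)))))

  length-contract≥3 : Good ws d → 3 ≤ length (contract d ws)
  length-contract≥3 {ws} {a , b} g = case Good.outside g of λ (x , x∈ , out) →
    length-mono {xs = a ∷ b ∷ x ∷ []}
      ((<⇒≢ a<b ∷ a≢ out ∷ []) ∷ (b≢ out ∷ []) ∷ [] ∷ [])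
      λ where
        (here refl) → keep (proj₁ ends) λ bt → <-irrefl refl (proj₁ bt)
        (there (here refl)) → keep (proj₂ ends) λ bt → <-irrefl refl (proj₂ bt)
        (there (there (here refl))) → keep x∈ λ bt → case out of λ where
          (inj₁ lt) → <-asym lt (proj₁ bt)
          (inj₂ gt) → <-asym gt (proj₂ bt)
    where
    open Good g renaming (segment to a<b)
    a≢ : ∀ {x} → Outside (a , b) x → a ≢ x
    a≢ (inj₁ lt) refl = <-irrefl refl lt
    a≢ (inj₂ gt) refl = <-asym gt a<b
    b≢ : ∀ {x} → Outside (a , b) x → b ≢ x
    b≢ (inj₁ lt) refl = <-asym lt a<b
    b≢ (inj₂ gt) refl = <-irrefl refl gt
    keep : ∀ {x} → x ∈ ws → ¬ Between (a , b) x → x ∈ contract (a , b) ws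
    keep = ∈-filter⁺ (¬? ∘ between? (a , b))

  -- `suc k` is the number of cells' worth of vertices cut off by `d`, and `suc l` the number left.
  -- Neither is zero: there is a vertex inside `d`, and at least three vertices survive.
  contract-size : ∀ n → length ws ≡ m * suc n + 2 → Good ws d →
    ∃[ k ] ∃[ l ] count ws d ≡ suc k * m × n ≡ suc k + l × length (contract d ws) ≡ m * suc l + 2
  contract-size {ws} {d} n len g with Good.divisible g
  ... | divides zero eq = case Good.between g of λ (x , x∈ , bt) →
        contradiction (subst (0 <_) eq (∈-length (∈-filter⁺ (between? d) x∈ bt))) (<-irrefl refl)
  ... | divides (suc k) eq with suc k ≤? n
  ...   | no k≰n = contradiction (begin-strict
            suc k * m + 2 <⟨ +-monoʳ-< (suc k * m) (length-contract≥3 {ws} {d} g) ⟩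
            suc k * m + length (contract d ws) ≡⟨ cong (_+ length (contract d ws)) eq ⟨
            count ws d + length (contract d ws) ≡⟨ length-contract ws d ⟨
            length ws ≡⟨ len ⟩
            m * suc n + 2 ≡⟨ cong (_+ 2) (*-comm m (suc n)) ⟩
            suc n * m + 2 ≤⟨ +-monoˡ-≤ 2 (*-monoˡ-≤ m (≰⇒> k≰n)) ⟩
            suc k * m + 2 ∎) (<-irrefl refl)
    where open ≤-Reasoning
  ...   | yes k≤n with l , refl ← m≤n⇒∃[o]m+o≡n k≤n =
          k , l , eq , refl , +-cancelˡ-≡ (suc k * m) _ _ (begin
            suc k * m + length (contract d ws) ≡⟨ cong (_+ length (contract d ws)) eq ⟨
            count ws d + length (contract d ws) ≡⟨ length-contract ws d ⟨
            length ws ≡⟨ len ⟩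
            m * suc (suc k + l) + 2
              ≡⟨ solve 3 (λ m k l → m :* (con 1 :+ (con 1 :+ k :+ l)) :+ con 2
                   := (con 1 :+ k) :* m :+ (m :* (con 1 :+ l) :+ con 2)) refl m k l ⟩
            suc k * m + (m * suc l + 2) ∎)
    where open ≡-Reasoning

  -- Contracting along an ear removes one diagonal and at least one cell. The recursion is on `j`,
  -- since the remaining diagonals are known only up to permutation.
  Valid⇒length≤ : ∀ j D n → length D ≡ j → Shell ws → length ws ≡ m * suc n + 2 → Valid ws D → j ≤ n
  Valid⇒length≤ zero D n _ _ _ _ = z≤n
  Valid⇒length≤ {ws} (suc j) D@(_ ∷ _) n eq s len v = case ear s v (here refl) of λ (d , E) →
    case remove-∈ (Ear.member E) of λ (D′ , p) →
    case contract-size {ws} {d} n len (Valid.good v (Ear.member E)) of λ where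
      (k , l , _ , n≡ , len′) → subst (suc j ≤_) (sym n≡) (s≤s (≤-trans
        (Valid⇒length≤ j D′ l (suc-injective (trans (sym (↭-length p)) eq))
          (Shell-filter (¬? ∘ between? d) s) len′
          (Valid-contract (Valid-↭ p v) (λ e∈ → Ear.innermost E (∈-resp-↭ (↭-sym p) (there e∈)))))
        (m≤n+m l k)))

  -- Encoding and decoding.

  -- The conditions of `Partition` in the recursive form that matches contraction. The bound on the
  -- head says that an ear with m inner vertices fits into the shell from position `v` on.
  data Parts : ∀ {n} → Vec ℕ n → Set where
    []  : Parts []
    cons : ∀ {n v} {λs : Vec ℕ n} → v ≤ m * suc n → (∀ i → lookup λs i ≤ v) → Parts λs →
      Parts (v ∷ λs)

  -- Each part v cuts off the ear of label v, and the remaining parts code a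
  -- dissection of the contracted polygon.
  data Codes : ∀ {n} → List ℕ → Vec ℕ n → List Segment → Set where
    []  : Codes ws [] []
    code : ∀ {n v} {λs : Vec ℕ n} → IsSegment d → Ends ws d → label ws d ≡ v → count ws d ≡ m →
      Codes (contract d ws) λs D → Codes ws (v ∷ λs) (d ∷ D)

  -- That every part is the label of some diagonal of `D` strengthens the induction: as the ear has
  -- the highest label, its part dominates the later ones.
  encode : ∀ n D → Shell ws → length ws ≡ m * suc n + 2 → Valid ws D → length D ≡ n →
    ∃[ λs ] Parts {n} λs × (∀ i → ∃[ d ] d ∈ D × label ws d ≡ lookup λs i) ×
      ∃[ D′ ] D ↭ D′ × Codes ws λs D′
  encode zero [] _ _ _ _ = [] , [] , (λ ()) , [] , ↭-refl , []
  encode {ws} (suc n) D@(_ ∷ _) s len v eq = case ear s v (here refl) of λ (d , E) →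
    case remove-∈ (Ear.member E) of λ (D₁ , p) → step d E D₁ p
    where
    step : ∀ d → Ear ws D d → ∀ D₁ → D ↭ d ∷ D₁ → _
    step d E D₁ p = finish (contract-size {ws} {d} (suc n) len (Valid.good v (Ear.member E)))
      where
      g : Good ws d
      g = Valid.good v (Ear.member E)
      s′ : Shell (contract d ws)
      s′ = Shell-filter (¬? ∘ between? d) s
      v′ : Valid (contract d ws) D₁
      v′ = Valid-contract (Valid-↭ p v) (λ e∈ → Ear.innermost E (∈-resp-↭ (↭-sym p) (there e∈)))
      eq′ : length D₁ ≡ n
      eq′ = suc-injective (trans (sym (↭-length p)) eq)
      label≡ : ∀ {e} → e ∈ D → label (contract d ws) e ≡ label ws e
      label≡ {e} e∈ = label-contract ws d e s (Good.ends g) (Ear.innermost E e∈)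
        (inj₁ (Ear.highest E e∈))
      finish : ∃[ k ] ∃[ l ]
        count ws d ≡ suc k * m × suc n ≡ suc k + l × length (contract d ws) ≡ m * suc l + 2 → _
      -- An ear with more than m inner vertices would leave too small a polygon
      -- for the other n diagonals.
      finish (suc k , l , _ , refl , len′) =
        contradiction (Valid⇒length≤ n D₁ l eq′ s′ len′ v′) (<⇒≱ (s≤s (m≤n+m l k)))
      finish (zero , _ , c , refl , len′) = case encode n D₁ s′ len′ v′ eq′ of λ where
          (λs , Λ , lab , D₂ , q , C) →
            label ws d ∷ λs ,
            cons (+-cancelʳ-≤ (suc (suc m)) (label ws d) (m * suc n)
                   (subst₂ _≤_ (cong (λ z → label ws d + suc (suc z)) c′)
                     (trans len
                       (solve 2 (λ m n → m :* (con 2 :+ n) :+ con 2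
                         := m :* (con 1 :+ n) :+ (con 2 :+ m)) refl m n))
                     (label-count-bound s (Good.segment g) (Good.ends g))))
                 (λ i → case lab i of λ (e , e∈ , l≡) → subst (_≤ label ws d)
                   (trans (sym (label≡ (D₁⊆D e∈))) l≡) (Ear.highest E (D₁⊆D e∈)))
                 Λ ,
            (λ where
              zero → d , Ear.member E , refl
              (suc i) → case lab i of λ (e , e∈ , l≡) → e , D₁⊆D e∈ ,
                trans (sym (label≡ (D₁⊆D e∈))) l≡) ,
            d ∷ D₂ , ↭-trans p (prep d q) , code (Good.segment g) (Good.ends g) refl c′ C
        where
        c′ : count ws d ≡ m
        c′ = trans c (*-identityˡ m)
        D₁⊆D : ∀ {e} → e ∈ D₁ → e ∈ D
        D₁⊆D e∈ = ∈-resp-↭ (↭-sym p) (there e∈)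

  -- Positivity of `m` gives a vertex inside. Without a vertex outside, only the two ends would
  -- survive the contraction.
  ear-Good : .{{NonZero m}} → Unique ws → IsSegment d → Ends ws d → count ws d ≡ m →
    3 ≤ length (contract d ws) → Good ws d
  ear-Good {ws} {a , b} ws! a<b d∈ c l≥3 = record
    { segment = a<b
    ; ends = d∈
    ; divisible = divides 1 (trans c (sym (*-identityˡ m)))
    ; between = case nonempty (subst (0 <_) (sym c) (>-nonZero⁻¹ m)) of λ (x , x∈) →
        x , ∈-filter⁻ (between? (a , b)) x∈
    ; outside = case Any.any? out? ws of λ where
        (yes any) → find any
        (no none) →
          ⊥-elim (<⇒≱ l≥3 (length-mono {xs = contract (a , b) ws} {ys = a ∷ b ∷ []}
          (Unique.filter⁺ (¬? ∘ between? (a , b)) ws!) (inside none)))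
    }
    where
    out? : Decidable (Outside (a , b))
    out? x = (x <? a) ⊎-dec (b <? x)
    inside : ¬ Any (Outside (a , b)) ws → ∀ {x} → x ∈ contract (a , b) ws → x ∈ a ∷ b ∷ []
    inside none {x} x∈′
      with x∈ , ¬bt ← ∈-filter⁻ (¬? ∘ between? (a , b)) {xs = ws} x∈′ | <-cmp x a | <-cmp x b
    ... | tri< x<a _ _ | _ = contradiction (lose x∈ (inj₁ x<a)) none
    ... | tri≈ _ refl _ | _ = here refl
    ... | tri> _ _ a<x | tri< x<b _ _ = contradiction (a<x , x<b) ¬bt
    ... | tri> _ _ a<x | tri≈ _ refl _ = there (here refl)
    ... | tri> _ _ a<x | tri> _ _ b<x = contradiction (lose x∈ (inj₂ b<x)) none

  length-contract-m : ∀ ws d n → count ws d ≡ m → length ws ≡ m * suc n + 2 →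
    length (contract d ws) ≡ m * n + 2
  length-contract-m ws d n c len = +-cancelˡ-≡ m _ _ (begin
    m + length (contract d ws) ≡⟨ cong (_+ length (contract d ws)) c ⟨
    count ws d + length (contract d ws) ≡⟨ length-contract ws d ⟨
    length ws ≡⟨ len ⟩
    m * suc n + 2 ≡⟨ cong (_+ 2) (*-suc m n) ⟩
    m + m * n + 2 ≡⟨ +-assoc m (m * n) 2 ⟩
    m + (m * n + 2) ∎)
    where open ≡-Reasoning

  decode : .{{NonZero m}} → ∀ n (λs : Vec ℕ n) → Shell ws → length ws ≡ m * suc n + 2 → Parts λs →
    ∃[ D ] Codes ws λs D × Valid ws D × length D ≡ n
  decode zero [] _ _ _ =
    [] , [] , record { distinct = [] ; good = λ () ; noncrossing = λ () } , refl
  decode {ws} (suc n) (v ∷ λs) s len (cons v≤ _ Λ) =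
    case ear-exists s v m (subst (v + suc (suc m) ≤_) (sym len′) (+-monoˡ-≤ (suc (suc m)) v≤)) of λ where
        (d , a<b , d∈ , l , c) → step d a<b d∈ l c
    where
    len′ : length ws ≡ m * suc n + suc (suc m)
    len′ = trans len
      (solve 2 (λ m n → m :* (con 2 :+ n) :+ con 2 := m :* (con 1 :+ n) :+ (con 2 :+ m)) refl m n)
    step : ∀ d → IsSegment d → Ends ws d → label ws d ≡ v → count ws d ≡ m → _
    step d a<b d∈ l c = case decode n λs s′ len₁ Λ of λ where
          (D , C , V , lD) → d ∷ D , code a<b d∈ l c C , valid D V , cong suc lD
      where
      s′ : Shell (contract d ws)
      s′ = Shell-filter (¬? ∘ between? d) s
      len₁ : length (contract d ws) ≡ m * suc n + 2
      len₁ = length-contract-m ws d (suc n) c len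
      g : Good ws d
      g = ear-Good (Shell⇒Unique s) a<b d∈ c (subst (3 ≤_) (sym len₁)
            (+-monoˡ-≤ 2
              (subst (_≤ m * suc n) (*-identityˡ 1) (*-mono-≤ (>-nonZero⁻¹ m) (s≤s z≤n)))))
      valid : ∀ D → Valid (contract d ws) D → Valid ws (d ∷ D)
      valid D V = record
        { distinct = All.tabulate (λ {e} e∈ d≡e → d∉ (subst (_∈ D) (sym d≡e) e∈)) ∷ Valid.distinct V
        ; good =
          λ { (here refl) → g ; (there e∈) → Good-contract⁻ (Good.divisible g) (Valid.good V e∈) }
        ; noncrossing = λ where
            (here refl) (here refl) → λ where
              (inj₁ (a<a , _)) → <-irrefl refl a<a
              (inj₂ (a<a , _)) → <-irrefl refl a<a
            {e = e} (here refl) (there e∈) → away e e∈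
            {d = e} (there e∈) (here refl) → away e e∈ ∘ Crossing-sym e d
            (there e∈) (there f∈) → Valid.noncrossing V e∈ f∈
        }
        where
        -- A good diagonal has a vertex inside it, and the contraction has removed all those inside
        -- `d`.
        d∉ : ¬ d ∈ D
        d∉ d∈D with x , x∈ , bt ← Good.between (Valid.good V d∈D) =
          proj₂ (∈-filter⁻ (¬? ∘ between? d) {xs = ws} x∈) bt
        away : ∀ e → e ∈ D → NonCrossing d e
        away e e∈ =
          Avoids⇒NonCrossing d e (proj₂ (contract-Ends⁻ {d} {ws} {e} (Good.ends (Valid.good V e∈))))

  -- By `ear-unique` the head determines the ear, hence the contracted polygon for the remaining
  -- parts.
  Codes-functional : ∀ {n} {λs : Vec ℕ n} {D D′} → Shell ws → Codes ws λs D → Codes ws λs D′ →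
    D ≡ D′
  Codes-functional s [] [] = refl
  Codes-functional {ws} s (code {d} a<b d∈ l c C) (code {e} p<q e∈ l′ c′ C′)
    with refl ← ear-unique s a<b p<q d∈ e∈ (trans l (sym l′)) (trans c (sym c′)) =
    cong (d ∷_) (Codes-functional (Shell-filter (¬? ∘ between? d) s) C C′)

  Codes-Ends : ∀ {n} {λs : Vec ℕ n} → Codes ws λs D → e ∈ D → Ends ws e
  Codes-Ends (code _ d∈ _ _ _) (here refl) = d∈
  Codes-Ends {ws} {e = e} (code {d} _ _ _ _ C) (there e∈) =
    proj₁ (contract-Ends⁻ {d} {ws} {e} (Codes-Ends C e∈))

  Codes-label : ∀ {n} {λs : Vec ℕ n} → Shell ws → Parts λs → Codes ws λs D → e ∈ D →
    (∀ i → lookup λs i ≤ v) → label ws e ≤ v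
  Codes-label s Λ (code _ _ refl _ _) (here refl) h = h zero
  Codes-label {ws} {e = e} {v} s (cons _ top Λ) (code {d} _ d∈ refl _ C) (there e∈) h =
    -- The bound by the head is known for the label in the contracted polygon, hence the second form
    -- of the hypothesis of `label-contract`.
    subst (_≤ v) (label-contract ws d e s d∈ (proj₂ (contract-Ends⁻ {d} {ws} {e} (Codes-Ends C e∈)))
                   (inj₂ (Codes-label s′ Λ C e∈ top)))
      (Codes-label s′ Λ C e∈ (h ∘ suc))
    where
    s′ : Shell (contract d ws)
    s′ = Shell-filter (¬? ∘ between? d) s

  Parts-≤head : ∀ {n v} {λs : Vec ℕ n} → Parts (v ∷ λs) → ∀ i → lookup (v ∷ λs) i ≤ v
  Parts-≤head _ zero = ≤-refl
  Parts-≤head (cons _ top _) (suc i) = top i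

  -- The lists may be ordered differently, but each head has the highest label and m inner vertices,
  -- so the heads coincide.
  Codes-injective : ∀ {n} {λs λs′ : Vec ℕ n} {D D′} → Shell ws → Parts λs → Parts λs′ →
    Codes ws λs D → Codes ws λs′ D′ →
    Unique D → Unique D′ → (∀ {d} → d ∈ D ⇔ d ∈ D′) → λs ≡ λs′
  Codes-injective _ [] [] [] [] _ _ _ = refl
  Codes-injective s Λ@(cons _ _ Λ₁) Λ′@(cons _ _ Λ₁′) C@(code {d} {D = D} a<b d∈ refl c C₁)
    C′@(code {e} {D = D′} p<q e∈ refl c′ C₁′) (d∉ ∷ D!) (e∉ ∷ D′!) D⇔D′
    with l≡ ← ≤-antisym (Codes-label s Λ′ C′ (Equivalence.to D⇔D′ (here refl)) (Parts-≤head Λ′))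
                        (Codes-label s Λ C (Equivalence.from D⇔D′ (here refl)) (Parts-≤head Λ))
    with refl ← ear-unique s a<b p<q d∈ e∈ l≡ (trans c (sym c′)) =
    cong₂ _∷_ refl (Codes-injective (Shell-filter (¬? ∘ between? d) s) Λ₁ Λ₁′ C₁ C₁′ D! D′!
      (mk⇔ (λ f∈ → tail d∉ f∈ (Equivalence.to D⇔D′ (there f∈)))
        (λ f∈ → tail e∉ f∈ (Equivalence.from D⇔D′ (there f∈)))))
    where
    tail : ∀ {f D D′} → All (d ≢_) D → f ∈ D → f ∈ d ∷ D′ → f ∈ D′
    tail d∉ f∈ (here refl) = contradiction refl (All.lookup d∉ f∈)
    tail d∉ f∈ (there f∈′) = f∈′

  -- Closing chords and maximal parts.

  module _ .{{_ : NonZero m}} where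

    Chord-count-m : ∀ R k → Shell (R ++ Q) → Chord Q d → length Q ≡ m * k + 2 →
      count (R ++ Q) d ≡ m * k
    Chord-count-m R k S c lenQ = trans (count-++ R S (Chord.ends c))
      (+-cancelʳ-≡ 2 _ _ (trans (sym (Chord-count (Shell-++ʳ R S) c)) lenQ))

    -- Contracting an ear inside the arc Q shortens Q by m vertices and keeps its
    -- closing chord, hence the induction on i.
    Codes-Chord : ∀ {n} {λs : Vec ℕ n} R (i : Fin n) → Shell (R ++ Q) →
      length (R ++ Q) ≡ m * suc n + 2 → Parts λs → Codes (R ++ Q) λs D →
      Chord Q d → length Q ≡ m * suc (toℕ i) + 2 → d ∈ D ⇔ lookup λs i ≡ length R
    Codes-Chord {Q} {D} {d} {suc n} {v ∷ λs} R i S len Λ@(cons v≤ _ Λ₁)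
      C@(code {e} {D = D₁} p<q e∈ refl cnt C₁) c lenQ = go i lenQ
      where
      label≡ : label (R ++ Q) d ≡ length R
      label≡ = trans (label-++ R S (Chord.ends c))
        (trans (cong (length R +_) (Chord-label (Shell-++ʳ R S) c)) (+-identityʳ _))
      high : d ∈ D → length R ≤ v
      high d∈ = subst (_≤ v) label≡ (Codes-label S Λ C d∈ (Parts-≤head Λ))
      go : ∀ i → length Q ≡ m * suc (toℕ i) + 2 → d ∈ D ⇔ lookup (v ∷ λs) i ≡ length R
      -- Here `Q` has m + 2 vertices, so `d` has the shape of an ear, and `length R` is the upper
      -- bound on the first part.
      go zero lenQ = mk⇔
        (λ d∈ → ≤-antisym (subst (v ≤_) (sym lenR) v≤) (high d∈))
        (λ v≡ → here (ear-unique S (Chord.segment c) p<q (Ends-++ {Q} {d} R (Chord.ends c)) e∈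
          (trans label≡ (sym v≡))
          (trans (Chord-count-m R 1 S c lenQ) (trans (*-identityʳ m) (sym cnt)))))
        where
        lenR : length R ≡ m * suc n
        lenR = +-cancelʳ-≡ (length Q) _ _ (begin
          length R + length Q ≡⟨ length-++ R ⟨
          length (R ++ Q) ≡⟨ len ⟩
          m * suc (suc n) + 2
            ≡⟨ solve 2 (λ m n → m :* (con 2 :+ n) :+ con 2
                 := m :* (con 1 :+ n) :+ (m :* con 1 :+ con 2)) refl m n ⟩
          m * suc n + (m * 1 + 2) ≡⟨ cong (m * suc n +_) lenQ ⟨
          m * suc n + length Q ∎)
          where open ≡-Reasoning
      -- Now `d` cuts off more than m vertices, so it is not the ear `e`. Either side of the
      -- equivalence gives `length R ≤ v`, which places `e` in the arc `Q`.
      go (suc i) lenQ = mk⇔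
        (λ d∈ → Equivalence.to (rec (high d∈)) (tail d∈))
        (λ eq → there (Equivalence.from (rec (subst (_≤ v) eq (Parts-≤head Λ (suc i)))) eq))
        where
        tail : d ∈ e ∷ D₁ → d ∈ D₁
        tail (there d∈) = d∈
        tail (here refl) = case *-cancelˡ-≡ (suc (suc (toℕ i))) 1 m
          (trans (sym (Chord-count-m R (suc (suc (toℕ i))) S c lenQ))
          (trans cnt (sym (*-identityʳ m)))) of λ ()
        rec : length R ≤ v → d ∈ D₁ ⇔ lookup λs i ≡ length R
        rec R≤v = Codes-Chord R i (subst Shell split (Shell-filter (¬? ∘ between? e) S))
          (trans (cong length (sym split)) len₁) Λ₁
          (subst (λ l → Codes l λs D₁) split C₁) (Chord-contract eQ c) lenQ′
          where
          eQ : Ends Q e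
          eQ = Ends-++⁻ R e∈ R≤v
          split : contract e (R ++ Q) ≡ R ++ contract e Q
          split = contract-++ R S eQ
          len₁ : length (contract e (R ++ Q)) ≡ m * suc n + 2
          len₁ = length-contract-m (R ++ Q) e (suc n) cnt len
          lenQ′ : length (contract e Q) ≡ m * suc (toℕ i) + 2
          lenQ′ = length-contract-m Q e (suc (toℕ i)) (trans (sym (count-++ R S eQ)) cnt) lenQ

-- Intervals of labels and the snake.

record Interval (Q : List ℕ) (lo hi : ℕ) : Set where
  field
    shell : Shell Q
    lo≤hi : lo ≤ hi
    ∈⁺ : ∀ {x} → lo ≤ x → x ≤ hi → x ∈ Q
    ∈⁻ : ∀ {x} → x ∈ Q → lo ≤ x × x ≤ hi

extend-up : ∀ {lo hi} → Interval Q lo hi → Interval (suc hi ∷ Q) lo (suc hi)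
extend-up {hi = hi} I = record
  { shell = inj₂ (All.tabulate λ x∈ → s≤s (proj₂ (∈⁻ x∈))) ∷ shell
  ; lo≤hi = m≤n⇒m≤1+n lo≤hi
  ; ∈⁺ = λ {x} lo≤x x≤hi → case x ≟ suc hi of λ where
      (yes refl) → here refl
      (no x≢) → there (∈⁺ lo≤x (s≤s⁻¹ (≤∧≢⇒< x≤hi x≢)))
  ; ∈⁻ = λ where
      (here refl) → m≤n⇒m≤1+n lo≤hi , ≤-refl
      (there x∈) → proj₁ (∈⁻ x∈) , m≤n⇒m≤1+n (proj₂ (∈⁻ x∈))
  }
  where open Interval I

extend-down : ∀ {lo hi} → Interval Q (suc lo) hi → Interval (lo ∷ Q) lo hi
extend-down {lo = lo} I = record
  { shell = inj₁ (All.tabulate λ x∈ → proj₁ (∈⁻ x∈)) ∷ shell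
  ; lo≤hi = <⇒≤ lo≤hi
  ; ∈⁺ = λ {x} lo≤x x≤hi → case lo ≟ x of λ where
      (yes refl) → here refl
      (no lo≢x) → there (∈⁺ (≤∧≢⇒< lo≤x lo≢x) x≤hi)
  ; ∈⁻ = λ where
      (here refl) → ≤-refl , <⇒≤ lo≤hi
      (there x∈) → <⇒≤ (proj₁ (∈⁻ x∈)) , proj₂ (∈⁻ x∈)
  }
  where open Interval I

-- The vertex farthest from the old interval comes first, as the shell order requires.
upBlock downBlock : ℕ → ℕ → List ℕ
upBlock hi zero = []
upBlock hi (suc k) = suc (hi + k) ∷ upBlock hi k
downBlock lo zero = []
downBlock lo (suc k) = lo ∷ downBlock (suc lo) k

length-upBlock : ∀ hi k → length (upBlock hi k) ≡ k
length-upBlock hi zero = refl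
length-upBlock hi (suc k) = cong suc (length-upBlock hi k)

length-downBlock : ∀ lo k → length (downBlock lo k) ≡ k
length-downBlock lo zero = refl
length-downBlock lo (suc k) = cong suc (length-downBlock (suc lo) k)

upBlock-Interval : ∀ {lo} hi k → Interval Q lo hi → Interval (upBlock hi k ++ Q) lo (hi + k)
upBlock-Interval {Q} {lo} hi zero I = subst (Interval Q lo) (sym (+-identityʳ hi)) I
upBlock-Interval {Q} {lo} hi (suc k) I =
  subst (Interval (upBlock hi (suc k) ++ Q) lo) (sym (+-suc hi k))
    (extend-up (upBlock-Interval hi k I))

downBlock-Interval : ∀ lo k {hi} → Interval Q (lo + k) hi → Interval (downBlock lo k ++ Q) lo hi
downBlock-Interval {Q} lo zero {hi} I = subst (λ l → Interval Q l hi) (+-identityʳ lo) I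
downBlock-Interval {Q} lo (suc k) {hi} I =
  extend-down (downBlock-Interval (suc lo) k (subst (λ l → Interval Q l hi) (+-suc lo k) I))

Interval-Chord : ∀ {lo hi} → lo < hi → Interval Q lo hi → Chord Q (lo , hi)
Interval-Chord lo<hi I = record
  { segment = lo<hi
  ; ends = ∈⁺ ≤-refl lo≤hi , ∈⁺ lo≤hi ≤-refl
  ; spans = ∈⁻
  }
  where open Interval I

-- The cases are i even and i odd; they decide at which end the snake grows.
halves : ∀ i → ⌈ i /2⌉ ≡ ⌊ i /2⌋ ⊎ ⌈ i /2⌉ ≡ suc ⌊ i /2⌋
halves zero = inj₁ refl
halves (suc zero) = inj₂ refl
halves (suc (suc i)) = Sum.map (cong suc) (cong suc) (halves i)

-- snake i is the arc of m i + 2 vertices cut off by -αᵢ, after the rotation that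
-- moves the vertex 0 to suc (c * m). For i ≤ 2 c the subtraction in lo is not truncated.
module Snake (m c : ℕ) where

  -- The ends of the rotated -αᵢ. For i = 0 they are the adjacent vertices from which the snake
  -- starts.
  lo hi : ℕ → ℕ
  lo i = (c ∸ ⌈ i /2⌉) * m
  hi i = suc (c * m) + ⌊ i /2⌋ * m

  block : ℕ → List ℕ
  block i with halves i
  ... | inj₁ _ = downBlock (lo (suc i)) m
  ... | inj₂ _ = upBlock (hi i) m

  snake : ℕ → List ℕ
  snake zero = suc (c * m) ∷ c * m ∷ []
  snake (suc i) = block i ++ snake i

  length-block : ∀ i → length (block i) ≡ m
  length-block i with halves i
  ... | inj₁ _ = length-downBlock (lo (suc i)) m
  ... | inj₂ _ = length-upBlock (hi i) m

  length-snake : ∀ i → length (snake i) ≡ m * i + 2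
  length-snake zero = cong (_+ 2) (sym (*-zeroʳ m))
  length-snake (suc i) = begin
    length (block i ++ snake i) ≡⟨ length-++ (block i) ⟩
    length (block i) + length (snake i) ≡⟨ cong₂ _+_ (length-block i) (length-snake i) ⟩
    m + (m * i + 2) ≡⟨ +-assoc m (m * i) 2 ⟨
    m + m * i + 2 ≡⟨ cong (_+ 2) (*-suc m i) ⟨
    m * suc i + 2 ∎
    where open ≡-Reasoning

  snake-suffix : ∀ i r → ∃[ R ] snake (r + i) ≡ R ++ snake i × length R ≡ r * m
  snake-suffix i zero = [] , refl , refl
  snake-suffix i (suc r) with R , eq , len ← snake-suffix i r =
    block (r + i) ++ R ,
    trans (cong (block (r + i) ++_) eq) (sym (++-assoc (block (r + i)) R (snake i))) ,
    trans (length-++ (block (r + i))) (cong₂ _+_ (length-block (r + i)) len)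

  snake-Interval : ∀ i → ⌈ i /2⌉ ≤ c → Interval (snake i) (lo i) (hi i)
  snake-Interval zero _ = subst₂ (Interval (snake zero)) refl (sym (+-identityʳ _))
    (extend-up record
    { shell = inj₁ [] ∷ []
    ; lo≤hi = ≤-refl
    ; ∈⁺ = λ l≤x x≤l → here (≤-antisym x≤l l≤x)
    ; ∈⁻ = λ { (here refl) → ≤-refl , ≤-refl }
    })
  -- By definition `⌈ suc i /2⌉` is `suc ⌊ i /2⌋` and `⌊ suc i /2⌋` is `⌈ i /2⌉`, so `eq` tells
  -- which end stays and which one moves by `m`.
  snake-Interval (suc i) le with halves i | snake-Interval i (≤-trans (⌈n/2⌉-mono (n≤1+n i)) le)
  ... | inj₁ eq | I = subst (Interval _ _) (cong (λ z → suc (c * m) + z * m) (sym eq))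
        (downBlock-Interval (lo (suc i)) m (subst (λ l → Interval (snake i) l (hi i)) lo≡ I))
    where
    open ≡-Reasoning
    lo≡ : lo i ≡ lo (suc i) + m
    lo≡ = begin
      (c ∸ ⌈ i /2⌉) * m ≡⟨ cong (λ z → (c ∸ z) * m) eq ⟩
      (c ∸ ⌊ i /2⌋) * m ≡⟨ cong (_* m) (+-∸-assoc 1 le) ⟩
      suc (c ∸ suc ⌊ i /2⌋) * m ≡⟨ +-comm m _ ⟩
      (c ∸ suc ⌊ i /2⌋) * m + m ∎
  ... | inj₂ eq | I = subst₂ (Interval _) (cong (λ z → (c ∸ z) * m) eq) hi≡
    (upBlock-Interval (hi i) m I)
    where
    open ≡-Reasoning
    hi≡ : hi i + m ≡ hi (suc i)
    hi≡ = begin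
      suc (c * m) + ⌊ i /2⌋ * m + m ≡⟨ +-assoc (suc (c * m)) _ m ⟩
      suc (c * m) + (⌊ i /2⌋ * m + m) ≡⟨ cong (suc (c * m) +_) (+-comm _ m) ⟩
      suc (c * m) + suc ⌊ i /2⌋ * m ≡⟨ cong (λ z → suc (c * m) + z * m) eq ⟨
      suc (c * m) + ⌈ i /2⌉ * m ∎

-- Rotations of the polygon.

module Rotation (N : ℕ) where

  -- Adds 1 to both endpoints modulo N.
  rot : Segment → Segment
  rot (a , b) with suc b ≟ N
  ... | yes _ = 0 , suc a
  ... | no _ = suc a , suc b

  rot-wrap : ∀ {a b} → suc b ≡ N → rot (a , b) ≡ (0 , suc a)
  rot-wrap {b = b} eq with suc b ≟ N
  ... | yes _ = refl
  ... | no ≢ = contradiction eq ≢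

  rot-shift : ∀ {a b} → suc b ≢ N → rot (a , b) ≡ (suc a , suc b)
  rot-shift {b = b} ≢ with suc b ≟ N
  ... | yes eq = contradiction eq ≢
  ... | no _ = refl

  rot-injective : rot d ≡ rot e → d ≡ e
  rot-injective {a , b} {p , q} eq with suc b ≟ N | suc q ≟ N
  rot-injective refl | yes b≡ | yes q≡ = cong (_ ,_) (suc-injective (trans b≡ (sym q≡)))
  rot-injective refl | no _ | no _ = refl
  rot-injective () | yes _ | no _
  rot-injective () | no _ | yes _

  -- If only one segment wraps around, the two kinds of interleaving are exchanged, and its old
  -- upper end, the last vertex, exceeds that of the other. If both wrap, they share the end 0.
  rot-Crossing⁻ : IsDiagonal N d → IsDiagonal N e → Crossing (rot d) (rot e) → Crossing d e
  rot-Crossing⁻ {a , b} {p , q} (_ , b<N , _) (_ , q<N , _) x with suc b ≟ N | suc q ≟ N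
  rot-Crossing⁻ _ _ (inj₁ (s≤s a<p , s≤s p<b , s≤s b<q)) | no _ | no _ = inj₁ (a<p , p<b , b<q)
  rot-Crossing⁻ _ _ (inj₂ (s≤s p<a , s≤s a<q , s≤s q<b)) | no _ | no _ = inj₂ (p<a , a<q , q<b)
  rot-Crossing⁻ _ (_ , q<N , _) (inj₁ (_ , s≤s p<a , s≤s a<q)) | yes b≡ | no q≢ =
    inj₂ (p<a , a<q , s≤s⁻¹ (subst (suc _ ≤_) (sym b≡) (≤∧≢⇒< q<N q≢)))
  rot-Crossing⁻ (_ , b<N , _) _ (inj₂ (_ , s≤s a<p , s≤s p<b)) | no b≢ | yes q≡ =
    inj₁ (a<p , p<b , s≤s⁻¹ (subst (suc _ ≤_) (sym q≡) (≤∧≢⇒< b<N b≢)))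
  rot-Crossing⁻ _ _ (inj₁ (() , _)) | yes _ | yes _
  rot-Crossing⁻ _ _ (inj₂ (() , _)) | yes _ | yes _

  rot^ : ℕ → Segment → Segment
  rot^ zero d = d
  rot^ (suc k) d = rot (rot^ k d)

  rot^-+ : ∀ j k d → rot^ (j + k) d ≡ rot^ j (rot^ k d)
  rot^-+ zero k d = refl
  rot^-+ (suc j) k d = cong rot (rot^-+ j k d)

  rot^-injective : ∀ k → rot^ k d ≡ rot^ k e → d ≡ e
  rot^-injective zero eq = eq
  rot^-injective (suc k) eq = rot^-injective k (rot-injective eq)

  rot^-shift : ∀ k {a b} → k + b < N → rot^ k (a , b) ≡ (k + a , k + b)
  rot^-shift zero _ = refl
  rot^-shift (suc k) k+b<N = trans (cong rot (rot^-shift k (<⇒≤ k+b<N))) (rot-shift (<⇒≢ k+b<N))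

  -- After `j` shifts the upper end is the last vertex, the next step wraps it to 0, and the other
  -- `k` steps are shifts.
  rot^-turn : ∀ j k {a b} → j + suc b ≡ N → k + suc (j + a) < N →
    rot^ (k + suc j) (a , b) ≡ (k , k + suc (j + a))
  rot^-turn j k {a} {b} j+b k<N = begin
    rot^ (k + suc j) (a , b) ≡⟨ rot^-+ k (suc j) (a , b) ⟩
    rot^ k (rot (rot^ j (a , b)))
      ≡⟨ cong (rot^ k ∘ rot) (rot^-shift j (≤-reflexive (trans (sym (+-suc j b)) j+b))) ⟩
    rot^ k (rot (j + a , j + b)) ≡⟨ cong (rot^ k) (rot-wrap (trans (sym (+-suc j b)) j+b)) ⟩
    rot^ k (0 , suc (j + a)) ≡⟨ rot^-shift k k<N ⟩
    (k + 0 , k + suc (j + a)) ≡⟨ cong (_, k + suc (j + a)) (+-identityʳ k) ⟩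
    (k , k + suc (j + a)) ∎
    where open ≡-Reasoning

  rot^-full : ∀ {a b} → a < b → b < N → rot^ N (a , b) ≡ (a , b)
  rot^-full {a} {b} a<b b<N
    -- Each end wraps once: the upper one at step j + 1, the lower one t + 1 steps later, and `a`
    -- further shifts restore the segment.
    with t , refl ← m≤n⇒∃[o]m+o≡n a<b | j , eq ← m≤n⇒∃[o]m+o≡n b<N = begin
    rot^ N (a , suc (a + t))
      ≡⟨ cong (λ k → rot^ k (a , suc (a + t))) (trans (sym eq) (solve 3
           (λ a t j → con 2 :+ (a :+ t) :+ j := a :+ (con 1 :+ t) :+ (con 1 :+ j)) refl a t j)) ⟩
    rot^ (a + suc t + suc j) (a , suc (a + t)) ≡⟨ rot^-+ (a + suc t) (suc j) _ ⟩
    rot^ (a + suc t) (rot^ (suc j) (a , suc (a + t)))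
      ≡⟨ cong (rot^ (a + suc t)) (rot^-turn j 0 (trans (+-comm j _) eq)
           (subst (suc j + a <_) (trans (solve 3
             (λ a t j → con 1 :+ j :+ a :+ (con 1 :+ t) := con 2 :+ (a :+ t) :+ j) refl a t j) eq)
             (m<m+n (suc j + a) (s≤s z≤n)))) ⟩
    rot^ (a + suc t) (0 , suc (j + a)) ≡⟨ rot^-turn t a
      (trans (solve 3 (λ a t j → t :+ (con 2 :+ (j :+ a)) := con 2 :+ (a :+ t) :+ j) refl a t j) eq)
      (subst (_< N) (trans (sym (+-suc a t)) (cong (λ z → a + suc z) (sym (+-identityʳ t)))) b<N) ⟩
    (a , a + suc (t + 0))
      ≡⟨ cong (λ z → (a , z)) (trans (+-suc a (t + 0)) (cong (λ z → suc (a + z)) (+-identityʳ t))) ⟩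
    (a , suc (a + t)) ∎
    where open ≡-Reasoning

  rot^-multiple : ∀ k {a b} → a < b → b < N → rot^ (k * N) (a , b) ≡ (a , b)
  rot^-multiple zero _ _ = refl
  rot^-multiple (suc k) {a} {b} a<b b<N = trans (rot^-+ N (k * N) (a , b))
    (trans (cong (rot^ N) (rot^-multiple k a<b b<N)) (rot^-full a<b b<N))

module _ (m n : ℕ) .{{_ : NonZero m}} where

  private
    N : ℕ
    N = polygonSize m n

  open Rotation N

  rot-IsMDiagonal : IsMDiagonal m n d → IsMDiagonal m n (rot d)
  rot-IsMDiagonal {a , b} ((a<b , b<N , sa≢b , ¬side) , inner , outer) with suc b ≟ N
  ... | no b≢ = (s≤s a<b , ≤∧≢⇒< b<N b≢ , sa≢b ∘ suc-injective , λ ()) , inner , outer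
  -- Wrapping exchanges the inner and the outer polygon, so the two congruences change places.
  ... | yes b≡ =
    (s≤s z≤n , ≤-trans (s≤s a<b) b<N , (λ eq → ¬side (sym (suc-injective eq) , b≡)) ,
      λ (_ , eq) → sa≢b (suc-injective (trans eq (sym b≡)))) ,
    trans (cong (λ z → (z + 1) % m) swap) outer ,
    trans (cong (λ z → (z ∸ suc a + 1) % m) (sym b≡)) inner
    where
    swap : suc a ≡ N ∸ (b ∸ a)
    swap = trans (sym (trans (+-∸-assoc 1 (m∸n≤m b a)) (cong suc (m∸[m∸n]≡n (<⇒≤ a<b)))))
      (cong (_∸ (b ∸ a)) b≡)

  rot^-IsMDiagonal : ∀ k → IsMDiagonal m n d → IsMDiagonal m n (rot^ k d)
  rot^-IsMDiagonal zero D = D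
  rot^-IsMDiagonal (suc k) D = rot-IsMDiagonal (rot^-IsMDiagonal k D)

  rot^-Crossing⁻ : ∀ k → IsMDiagonal m n d → IsMDiagonal m n e → Crossing (rot^ k d) (rot^ k e) →
    Crossing d e
  rot^-Crossing⁻ zero _ _ x = x
  rot^-Crossing⁻ (suc k) D E x =
    rot^-Crossing⁻ k D E
      (rot-Crossing⁻ (proj₁ (rot^-IsMDiagonal k D)) (proj₁ (rot^-IsMDiagonal k E)) x)

  rotate : ℕ → Dissection m n → Dissection m n
  rotate k D = record
    { diagonals = map (rot^ k) (diagonals D)
    ; unique = Unique.map⁺ (rot^-injective k) (unique D)
    ; size = trans (length-map (rot^ k) (diagonals D)) (size D)
    ; allMDiagonal = All.map⁺ (All.map (rot^-IsMDiagonal k) (allMDiagonal D))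
    ; nonCrossing = AllPairs.map⁺ (noncross (allMDiagonal D) (nonCrossing D))
    }
    where
    noncross : ∀ {ds} → All (IsMDiagonal m n) ds → AllPairs NonCrossing ds →
      AllPairs (λ d e → NonCrossing (rot^ k d) (rot^ k e)) ds
    noncross [] [] = []
    noncross (D ∷ Ds) (nc ∷ ncs) = All.zipWith (λ (E , nc) → nc ∘ rot^-Crossing⁻ k D E) (Ds , nc) ∷
      noncross Ds ncs

-- From m-diagonals to good segments and back.

between-list : ℕ → ℕ → List ℕ
between-list a b = applyDownFrom (λ j → suc a + j) (b ∸ suc a)

count-all : ∀ {a b} → Unique ws → (∀ {x} → x < b → x ∈ ws) → count ws (a , b) ≡ b ∸ suc a
count-all {ws} {a} {b} ws! all = trans (≤-antisym
  (length-mono (Unique.filter⁺ (between? (a , b)) ws!) λ x∈′ →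
    case ∈-filter⁻ (between? (a , b)) {xs = ws} x∈′ of λ where
      (_ , a<x , x<b) → subst (_∈ between-list a b) (m+[n∸m]≡n a<x)
        (∈-applyDownFrom⁺ (λ j → suc a + j) (∸-monoˡ-< x<b a<x)))
  (length-mono (Unique.applyDownFrom⁺₁ (λ j → suc a + j) (b ∸ suc a) λ j<i _ eq →
    <⇒≢ j<i (sym (+-cancelˡ-≡ (suc a) _ _ eq)))
    λ x∈′ → case ∈-applyDownFrom⁻ (λ j → suc a + j) x∈′ of λ where
      (j , j< , refl) → ∈-filter⁺ (between? (a , b)) (all (below j<)) (s≤s (m≤m+n a j) , below j<)))
  (length-applyDownFrom (λ j → suc a + j) (b ∸ suc a))
  where
  0<n∸m⇒m<n : ∀ {m n} → 0 < n ∸ m → m < n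
  0<n∸m⇒m<n {m} 0< = ≰⇒> λ n≤m → <⇒≢ 0< (sym (m≤n⇒m∸n≡0 n≤m))
  below : ∀ {j} → j < b ∸ suc a → suc a + j < b
  below {j} j< = subst (suc a + j <_) (m+[n∸m]≡n (<⇒≤ (0<n∸m⇒m<n {suc a} (≤-<-trans z≤n j<))))
    (+-monoʳ-< (suc a) j<)

AllPairs-tabulate : ∀ {R : A → A → Set} {xs} → (∀ {x y} → x ∈ xs → y ∈ xs → R x y) → AllPairs R xs
AllPairs-tabulate {xs = []} r = []
AllPairs-tabulate {xs = x ∷ xs} r = All.tabulate (λ y∈ → r (here refl) (there y∈)) ∷
  AllPairs-tabulate (λ x∈ y∈ → r (there x∈) (there y∈))

NonCrossing-refl : ∀ d → NonCrossing d d
NonCrossing-refl d (inj₁ (a<a , _)) = <-irrefl refl a<a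
NonCrossing-refl d (inj₂ (a<a , _)) = <-irrefl refl a<a

NonCrossing-lookup : AllPairs NonCrossing D → d ∈ D → e ∈ D → NonCrossing d e
NonCrossing-lookup {d = d} _ (here refl) (here refl) = NonCrossing-refl d
NonCrossing-lookup (nc ∷ _) (here refl) (there e∈) = All.lookup nc e∈
NonCrossing-lookup {d = d} {e = e} (nc ∷ _) (there d∈) (here refl) =
  All.lookup nc d∈ ∘ Crossing-sym d e
NonCrossing-lookup (_ ∷ ncs) (there d∈) (there e∈) = NonCrossing-lookup ncs d∈ e∈

%≡⇒∣ : ∀ m .{{_ : NonZero m}} t k → (t + k) % m ≡ k % m → m ∣ t
%≡⇒∣ m t k eq = ∣m+n∣m⇒∣n (divides ((t + k) / m) (+-cancelˡ-≡ (k % m) _ _ (begin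
  k % m + (k / m * m + t)
    ≡⟨ solve 3 (λ r t q → r :+ (q :+ t) := t :+ (r :+ q)) refl (k % m) t (k / m * m) ⟩
  t + (k % m + k / m * m) ≡⟨ cong (t +_) (m≡m%n+[m/n]*n k m) ⟨
  t + k ≡⟨ m≡m%n+[m/n]*n (t + k) m ⟩
  (t + k) % m + (t + k) / m * m ≡⟨ cong (_+ (t + k) / m * m) eq ⟩
  k % m + (t + k) / m * m ∎))) (divides (k / m) refl)
  where open ≡-Reasoning

module Vertices (m n : ℕ) .{{_ : NonZero m}} where

  N c : ℕ
  N = polygonSize m n
  -- With this value `lo (n + 1)` is 0, so the last snake covers all the vertices.
  c = ⌈ n + 1 /2⌉

  open Polygon m
  open Rotation N
  open Snake m c

  vertices : List ℕ
  vertices = snake (n + 1)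

  suc-hi : suc (hi (n + 1)) ≡ N
  suc-hi = begin
    suc (suc (c * m) + ⌊ n + 1 /2⌋ * m)
      ≡⟨ solve 3 (λ c f m → con 2 :+ (c :* m) :+ f :* m := m :* (f :+ c) :+ con 2) refl
           c ⌊ n + 1 /2⌋ m ⟩
    m * (⌊ n + 1 /2⌋ + c) + 2 ≡⟨ cong (λ k → m * k + 2) (⌊n/2⌋+⌈n/2⌉≡n (n + 1)) ⟩
    N ∎
    where open ≡-Reasoning

  vertices-Interval : Interval vertices 0 (hi (n + 1))
  vertices-Interval = subst (λ z → Interval vertices (z * m) (hi (n + 1))) (n∸n≡0 c)
    (snake-Interval (n + 1) ≤-refl)

  vertices-Shell : Shell vertices
  vertices-Shell = Interval.shell vertices-Interval

  ∈-vertices⁺ : x < N → x ∈ vertices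
  ∈-vertices⁺ {x} x<N = Interval.∈⁺ vertices-Interval z≤n (s≤s⁻¹ (subst (x <_) (sym suc-hi) x<N))

  ∈-vertices⁻ : x ∈ vertices → x < N
  ∈-vertices⁻ {x} x∈ = subst (x <_) suc-hi (s≤s (proj₂ (Interval.∈⁻ vertices-Interval x∈)))

  length-vertices : length vertices ≡ m * suc n + 2
  length-vertices = trans (length-snake (n + 1)) (cong (λ k → m * k + 2) (+-comm n 1))

  count-vertices : ∀ {a b} → b < N → count vertices (a , b) ≡ b ∸ suc a
  count-vertices b<N = count-all (Shell⇒Unique vertices-Shell)
    (λ x<b → ∈-vertices⁺ (<-trans x<b b<N))

  innerSize-+ : ∀ {a b} → a < b → innerSize (a , b) ≡ b ∸ suc a + 2
  innerSize-+ {a} {b} a<b = trans (cong (_+ 1) (sym (m∸n+n≡m {b ∸ a} {1} (m<n⇒0<n∸m a<b))))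
    (trans (+-assoc (b ∸ a ∸ 1) 1 1)
      (cong (_+ 2) (trans (∸-+-assoc b a 1) (cong (b ∸_) (+-comm a 1)))))

  IsMDiagonal⇒Good : IsMDiagonal m n d → Good vertices d
  IsMDiagonal⇒Good {a , b} ((a<b , b<N , sa≢b , ¬side) , inner , _) = record
    { segment = a<b
    ; ends = ∈-vertices⁺ (<-trans a<b b<N) , ∈-vertices⁺ b<N
    ; divisible = subst (m ∣_) (sym (count-vertices b<N))
      (%≡⇒∣ m (b ∸ suc a) 2 (trans (cong (_% m) (sym (innerSize-+ a<b))) inner))
    ; between = suc a , ∈-vertices⁺ (≤-<-trans a<b b<N) , ≤-refl , ≤∧≢⇒< a<b sa≢b
    ; outside = case a ≟ 0 of λ where
        (yes a≡0) → suc b , ∈-vertices⁺ (≤∧≢⇒< b<N (λ eq → ¬side (a≡0 , eq))) , inj₂ ≤-refl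
        (no a≢0) → 0 , ∈-vertices⁺ (≤-<-trans z≤n b<N) , inj₁ (n≢0⇒n>0 a≢0)
    }

  -- The inner vertices and the outer size add up to `N`, which is 2 modulo `m`, so divisibility of
  -- the count gives the outer congruence too.
  Good⇒IsMDiagonal : Good vertices d → IsMDiagonal m n d
  Good⇒IsMDiagonal {a , b} g =
    (a<b , b<N ,
      (λ { refl → case between of λ (x , _ , a<x , x<b) → <⇒≱ a<x (s≤s⁻¹ x<b) }) ,
      (λ { (refl , eq) → case outside of λ where
        (x , x∈ , inj₂ b<x) → <⇒≱ (∈-vertices⁻ x∈) (subst (_≤ x) eq b<x) })) ,
    trans (cong (_% m) (innerSize-+ a<b)) (%-remove-+ˡ 2 m∣t) ,
    (begin
      (N ∸ (b ∸ a) + 1) % m ≡⟨ %-remove-+ˡ (N ∸ (b ∸ a) + 1) m∣t ⟨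
      (b ∸ suc a + (N ∸ (b ∸ a) + 1)) % m ≡⟨ cong (_% m) total ⟩
      (m * (n + 1) + 2) % m ≡⟨ %-remove-+ˡ 2 (m∣m*n (n + 1)) ⟩
      2 % m ∎)
    where
    open Good g renaming (segment to a<b)
    open ≡-Reasoning
    b<N : b < N
    b<N = ∈-vertices⁻ (proj₂ ends)
    m∣t : m ∣ b ∸ suc a
    m∣t = subst (m ∣_) (count-vertices b<N) divisible
    total : b ∸ suc a + (N ∸ (b ∸ a) + 1) ≡ N
    total = begin
      b ∸ suc a + (N ∸ (b ∸ a) + 1) ≡⟨ solve 2 (λ t r → t :+ (r :+ con 1) := (con 1 :+ t) :+ r)
        refl (b ∸ suc a) (N ∸ (b ∸ a)) ⟩
      suc (b ∸ suc a) + (N ∸ (b ∸ a)) ≡⟨ cong (_+ (N ∸ (b ∸ a))) (+-∸-assoc 1 a<b) ⟨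
      b ∸ a + (N ∸ (b ∸ a)) ≡⟨ m+[n∸m]≡n (≤-trans (m∸n≤m b a) (<⇒≤ b<N)) ⟩
      N ∎

  Dissection⇒Valid : (D : Dissection m n) → Valid vertices (diagonals D)
  Dissection⇒Valid D = record
    { distinct = unique D
    ; good = λ d∈ → IsMDiagonal⇒Good (All.lookup (allMDiagonal D) d∈)
    ; noncrossing = NonCrossing-lookup (nonCrossing D)
    }

  Valid⇒Dissection : ∀ D → Valid vertices D → length D ≡ n → Dissection m n
  Valid⇒Dissection D V len = record
    { diagonals = D
    ; unique = Valid.distinct V
    ; size = len
    ; allMDiagonal = All.tabulate (λ d∈ → Good⇒IsMDiagonal (Valid.good V d∈))
    ; nonCrossing = AllPairs-tabulate (Valid.noncrossing V)
    }

-- Partitions in recursive form.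

Parts⇒Partition : ∀ {m n} {λs : Vec ℕ n} → Polygon.Parts m λs → Partition m n
Parts⇒Partition {m} {n} {λs} Λ = record
  { parts = λs
  ; decreasing = λ {i} {j} → dec Λ {i} {j}
  ; bounded = bnd Λ
  }
  where
  open Polygon m
  dec : ∀ {n} {λs : Vec ℕ n} → Parts λs → ∀ {i j} → i Fin.≤ j → lookup λs i ≥ lookup λs j
  dec Λ@(cons _ _ _) {zero} {j} _ = Parts-≤head Λ j
  dec (cons _ _ Λ) {suc i} {suc j} (s≤s i≤j) = dec Λ i≤j
  bnd : ∀ {n} {λs : Vec ℕ n} → Parts λs → ∀ i → lookup λs i ≤ m * (n ∸ index i + 1)
  bnd {suc n} (cons {v = v} v≤ _ _) zero = subst (λ k → v ≤ m * k) (+-comm 1 n) v≤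
  bnd (cons _ _ Λ) (suc i) = bnd Λ i

Partition⇒Parts : ∀ {m n} (p : Partition m n) → Polygon.Parts m (parts p)
Partition⇒Parts {m} p = go (parts p) (λ {i} {j} → decreasing p {i} {j}) (bounded p)
  where
  open Polygon m
  go : ∀ {n} (λs : Vec ℕ n) → (∀ {i j} → i Fin.≤ j → lookup λs i ≥ lookup λs j) →
    (∀ i → lookup λs i ≤ m * (n ∸ index i + 1)) → Parts λs
  go [] _ _ = []
  go {suc n} (v ∷ λs) dec bnd = cons (subst (λ k → v ≤ m * k) (+-comm n 1) (bnd zero))
    (λ i → dec {zero} {suc i} z≤n)
    (go λs (λ {i} {j} i≤j → dec {suc i} {suc j} (s≤s i≤j)) (bnd ∘ suc))

-- The bijection and the negative simple roots.

module Encodings (m n : ℕ) .{{_ : NonZero m}} where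
  open Polygon m
  open Vertices m n
  open Rotation N
  open Snake m c

  turns : ℕ
  turns = suc (c * m)

  -- The upper end `(n + 1 ∸ h) * m + 1` wraps to 0 after `h * m + 1` steps, which leaves `lo i` of
  -- the `turns`.
  rot^-negSimpleRoot : ∀ i → i ≤ n + 1 → rot^ turns (negSimpleRoot m n i) ≡ (lo i , hi i)
  rot^-negSimpleRoot i i≤ = begin
    rot^ turns (negSimpleRoot m n i) ≡⟨ cong (λ k → rot^ k (negSimpleRoot m n i)) turns≡ ⟩
    rot^ (lo i + suc (h * m)) (negSimpleRoot m n i)
      ≡⟨ rot^-turn (h * m) (lo i) total (subst (_< N) (sym hi≡) hi<N) ⟩
    (lo i , lo i + suc (h * m + ⌊ i /2⌋ * m)) ≡⟨ cong (lo i ,_) hi≡ ⟩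
    (lo i , hi i) ∎
    where
    open ≡-Reasoning
    h = ⌈ i /2⌉
    h≤c : h ≤ c
    h≤c = ⌈n/2⌉-mono i≤
    turns≡ : turns ≡ lo i + suc (h * m)
    turns≡ = begin
      suc (c * m) ≡⟨ cong (λ z → suc (z * m)) (m∸n+n≡m h≤c) ⟨
      suc ((c ∸ h + h) * m) ≡⟨ cong suc (*-distribʳ-+ m (c ∸ h) h) ⟩
      suc (lo i + h * m) ≡⟨ +-suc (lo i) (h * m) ⟨
      lo i + suc (h * m) ∎
    hi≡ : lo i + suc (h * m + ⌊ i /2⌋ * m) ≡ hi i
    hi≡ = trans (sym (+-assoc (lo i) (suc (h * m)) (⌊ i /2⌋ * m)))
      (cong (_+ ⌊ i /2⌋ * m) (sym turns≡))
    hi<N : hi i < N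
    hi<N = subst (hi i <_) suc-hi (s≤s (+-monoʳ-≤ (suc (c * m)) (*-monoˡ-≤ m (⌊n/2⌋-mono i≤))))
    total : h * m + suc ((n + 1 ∸ h) * m + 1) ≡ N
    total = begin
      h * m + suc ((n + 1 ∸ h) * m + 1)
        ≡⟨ solve 3 (λ h k m → h :* m :+ (con 1 :+ (k :* m :+ con 1)) := m :* (h :+ k) :+ con 2)
        refl h (n + 1 ∸ h) m ⟩
      m * (h + (n + 1 ∸ h)) + 2
        ≡⟨ cong (λ k → m * k + 2) (m+[n∸m]≡n (≤-trans (⌈n/2⌉-mono i≤) (⌈n/2⌉≤n (n + 1)))) ⟩
      N ∎

  -- Coding takes place in the rotated polygon; `ears` lists the rotated diagonals in the order of
  -- their removal.
  record Encoding (D : Dissection m n) : Set where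
    field
      {λs} : Vec ℕ n
      Λ : Parts λs
      {ears} : List Segment
      ears↭ : map (rot^ turns) (diagonals D) ↭ ears
      codes : Codes vertices λs ears

    ears! : Unique ears
    ears! = Unique-↭ ears↭ (unique (rotate m n turns D))

    ∈-ears : d ∈ diagonals D ⇔ rot^ turns d ∈ ears
    ∈-ears {d} = mk⇔ (λ d∈ → ∈-resp-↭ ears↭ (∈-map⁺ (rot^ turns) d∈))
      λ d∈ → case ∈-map⁻ (rot^ turns) (∈-resp-↭ (↭-sym ears↭) d∈) of λ (e , e∈ , eq) →
        subst (_∈ diagonals D) (sym (rot^-injective turns eq)) e∈

    ears-rot : d ∈ ears → ∃[ e ] d ≡ rot^ turns e
    ears-rot d∈ = case ∈-map⁻ (rot^ turns) (∈-resp-↭ (↭-sym ears↭) d∈) of λ (e , _ , eq) → e , eq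

  abstract
    encoding : ∀ D → Encoding D
    encoding D = case encode n (diagonals D⁺) vertices-Shell length-vertices (Dissection⇒Valid D⁺)
      (size D⁺) of λ where
        (_ , Λ , _ , _ , ears↭ , codes) → record { Λ = Λ ; ears↭ = ears↭ ; codes = codes }
      where
      D⁺ : Dissection m n
      D⁺ = rotate m n turns D

  open Encoding

  toPartition : Dissection m n → Partition m n
  toPartition D = Parts⇒Partition (Λ (encoding D))

  cong-to : ∀ D D′ → (∀ {d} → d ∈ diagonals D ⇔ d ∈ diagonals D′) →
    λs (encoding D) ≡ λs (encoding D′)
  cong-to D D′ D⇔D′ = Codes-injective vertices-Shell (Λ E) (Λ E′) (codes E) (codes E′) (ears! E)
    (ears! E′)
    (mk⇔ (⊆ E E′ (Equivalence.to D⇔D′)) (⊆ E′ E (Equivalence.from D⇔D′)))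
    where
    E = encoding D
    E′ = encoding D′
    ⊆ : ∀ {D D′} (E : Encoding D) (E′ : Encoding D′) →
      (∀ {d} → d ∈ diagonals D → d ∈ diagonals D′) → ∀ {d} → d ∈ ears E → d ∈ ears E′
    ⊆ E E′ D⊆D′ d∈ with e , refl ← ears-rot E d∈ =
      Equivalence.to (∈-ears E′) (D⊆D′ (Equivalence.from (∈-ears E) d∈))

  injective-to : ∀ D D′ → λs (encoding D) ≡ λs (encoding D′) → ∀ {d} →
    d ∈ diagonals D ⇔ d ∈ diagonals D′
  injective-to D D′ eq = mk⇔ (⊆ E E′ eq) (⊆ E′ E (sym eq))
    where
    E = encoding D
    E′ = encoding D′
    ⊆ : ∀ {D D′} (E : Encoding D) (E′ : Encoding D′) → λs E ≡ λs E′ → ∀ {d} → d ∈ diagonals D →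
      d ∈ diagonals D′
    ⊆ E E′ eq {d} d∈ = Equivalence.from (∈-ears E′) (subst (rot^ turns d ∈_)
      (Codes-functional vertices-Shell (subst (λ l → Codes vertices l (ears E)) eq (codes E))
        (codes E′)) (Equivalence.to (∈-ears E) d∈))

  -- The inverse rotation is a forward one completing `turns` to a multiple of `N`; the multiple
  -- `turns * N` keeps the subtraction from being truncated.
  rot^-undo : IsMDiagonal m n d → rot^ turns (rot^ (turns * N ∸ turns) d) ≡ d
  rot^-undo {d} ((a<b , b<N , _) , _) = trans (sym (rot^-+ turns _ d))
    (trans (cong (λ k → rot^ k d) (m+[n∸m]≡n (m≤m*n turns N {{>-nonZero (≤-<-trans z≤n b<N)}})))
      (rot^-multiple turns a<b b<N))

  surjective-to : (p : Partition m n) → ∃[ D ] λs (encoding D) ≡ parts p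
  surjective-to p = case decode n (parts p) vertices-Shell length-vertices
    (Partition⇒Parts p) of λ (D , C , V , len) → surj D C V len
    where
    surj : ∀ D → Codes vertices (parts p) D → Valid vertices D → length D ≡ n → _
    surj D C V len = D⁻ , Codes-injective vertices-Shell (Λ E) (Partition⇒Parts p) (codes E) C
      (ears! E) (Valid.distinct V)
        (mk⇔ ears⊆D D⊆ears)
      where
      D₀ : Dissection m n
      D₀ = Valid⇒Dissection D V len
      D⁻ : Dissection m n
      D⁻ = rotate m n (turns * N ∸ turns) D₀
      E : Encoding D⁻
      E = encoding D⁻
      mdiag : ∀ {d} → d ∈ D → IsMDiagonal m n d
      mdiag = All.lookup (allMDiagonal D₀)
      to-D : ∀ {d} → d ∈ diagonals D⁻ → rot^ turns d ∈ D
      to-D d∈ with e , e∈ , refl ← ∈-map⁻ (rot^ (turns * N ∸ turns)) d∈ =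
        subst (_∈ D) (sym (rot^-undo (mdiag e∈))) e∈
      ears⊆D : ∀ {d} → d ∈ ears E → d ∈ D
      ears⊆D d∈ with e , refl ← ears-rot E d∈ = to-D (Equivalence.from (∈-ears E) d∈)
      D⊆ears : ∀ {d} → d ∈ D → d ∈ ears E
      D⊆ears d∈ = subst (_∈ ears E) (rot^-undo (mdiag d∈))
        (Equivalence.to (∈-ears E) (∈-map⁺ (rot^ (turns * N ∸ turns)) d∈))

  contains-neg : ∀ (i : Fin n) D →
    ContainsNeg D i ⇔ lookup (λs (encoding D)) i ≡ (n ∸ index i + 1) * m
  -- The arc of -αᵢ is what follows n - i + 1 blocks of m vertices, whence the extremal value of the
  -- part.
  contains-neg i D = case snake-suffix (index i) (n ∸ index i + 1) of λ (R , eq , len) →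
    step R eq len
    where
    E = encoding D
    i≤ : index i ≤ n
    i≤ = toℕ<n i
    r+i : n ∸ index i + 1 + index i ≡ n + 1
    r+i = begin
      n ∸ index i + 1 + index i ≡⟨ +-assoc (n ∸ index i) 1 (index i) ⟩
      n ∸ index i + (1 + index i) ≡⟨ cong (n ∸ index i +_) (+-comm 1 (index i)) ⟩
      n ∸ index i + (index i + 1) ≡⟨ +-assoc (n ∸ index i) (index i) 1 ⟨
      n ∸ index i + index i + 1 ≡⟨ cong (_+ 1) (m∸n+n≡m i≤) ⟩
      n + 1 ∎
      where open ≡-Reasoning
    i≤′ : index i ≤ n + 1
    i≤′ = ≤-trans i≤ (m≤m+n n 1)
    step : ∀ R → snake (n ∸ index i + 1 + index i) ≡ R ++ snake (index i) →
      length R ≡ (n ∸ index i + 1) * m → _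
    step R eq len = mk⇔
      (λ d∈ → trans
        (Equivalence.to on-ears
        (subst (_∈ ears E) (rot^-negSimpleRoot (index i) i≤′) (Equivalence.to (∈-ears E) d∈))) len)
      (λ l≡ → Equivalence.from (∈-ears E)
        (subst (_∈ ears E) (sym (rot^-negSimpleRoot (index i) i≤′))
        (Equivalence.from on-ears (trans l≡ (sym len)))))
      where
      split : vertices ≡ R ++ snake (index i)
      split = trans (cong snake (sym r+i)) eq
      on-ears : (lo (index i) , hi (index i)) ∈ ears E ⇔ lookup (λs E) i ≡ length R
      on-ears = Codes-Chord R i (subst Shell split vertices-Shell)
        (trans (cong length (sym split)) length-vertices)
        (Λ E) (subst (λ l → Codes l (λs E) (ears E)) split (codes E))
        (Interval-Chord lo<hi (snake-Interval (index i) (⌈n/2⌉-mono i≤′))) (length-snake (index i))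
        where
        lo<hi : lo (index i) < hi (index i)
        lo<hi = s≤s (≤-trans (*-monoˡ-≤ m (m∸n≤m c ⌈ index i /2⌉)) (m≤m+n (c * m) _))

theorem1p4 : (m n : ℕ) .{{_ : NonZero m}} .{{_ : NonZero n}} →
    Σ[ ψ ∈ Bijection (Dissections m n) (Partitions m n) ]
    ((i : Fin n) (D : Dissection m n) →
    ContainsNeg D i ⇔ part (Bijection.to ψ D) i ≡ (n ∸ index i + 1) * m)
theorem1p4 m n = record
    { to = toPartition
    ; cong = λ {D} {D′} → cong-to D D′
    ; bijective = (λ {D} {D′} eq → injective-to D D′ eq) ,
        λ p → case surjective-to p of λ (D , eq) → D , λ {D′} D′~D →
          trans (cong-to D′ D (λ {d} → D′~D {d})) eq
    } , contains-neg
  where open Encodings m n
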